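{- For all non-negative integers $n$ and $k$, $\mathcal A_{n,k}\in\mathbb Z$.
   Context: For non-negative integers $n,k$, define $\mathcal A_{n,k}:=\sum_{h\ge 0}B_h\binom{k+h-1}{h}{n\brack h+k}n^h$, where: $B_h$ are the Bernoulli numbers ($\frac{t}{e^t-1}=\sum_{h\ge0}B_h\frac{t^h}{h!}$, so $B_1=-\tfrac12$); ${n\brack m}$ is the unsigned Stirling number of the first kind, defined by $\sum_m{n\brack m}x^m=\prod_{j=0}^{n-1}(x+j)$ and vanishing for $m>n$; binomial coefficients $\binom{N}{h}$ for any integer $N$ are defined by $\sum_h\binom{N}{h}x^h=(1+x)^N$; and $0^0=1$. -}

module Defs where

open import Data.Nat as ℕ using (ℕ; zero; suc; _!)
open import Data.Nat.Combinatorics using (_C_)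
open import Data.Nat.Properties using (_!≢0)
open import Data.Integer as ℤ using (ℤ; +_)
open import Data.Rational as ℚ using (ℚ; _/_)
open import Data.List using (List; []; _∷_; _++_; [_])

Σ< : ℕ → (ℕ → ℚ) → ℚ
Σ< zero    f = ℚ.0ℚ
Σ< (suc m) f = Σ< m f ℚ.+ f m

ℕ→ℚ : ℕ → ℚ
ℕ→ℚ n = (+ n) / 1

-- Bernoulli numbers with B₁ = -1/2, via the standard recurrence
--   Σ_{j=0}^{m} C(m+1,j) B_j = 0  (m ≥ 1),  B₀ = 1,
-- which is equivalent to t/(e^t - 1) = Σ B_h t^h / h!.
-- bernoulliList m = [B₀, …, B_m]
private
  nth : List ℚ → ℕ → ℚ
  nth []       _       = ℚ.0ℚ
  nth (x ∷ xs) zero    = x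
  nth (x ∷ xs) (suc j) = nth xs j

bernoulliList : ℕ → List ℚ
bernoulliList zero    = [ ℚ.1ℚ ]
bernoulliList (suc m) =
  let prev = bernoulliList m
      s    = Σ< (suc m) (λ j → ℕ→ℚ (suc (suc m) C j) ℚ.* nth prev j)
  in prev ++ [ ℚ.- (s ℚ.* ((+ 1) / suc (suc m))) ]

Bernoulli : ℕ → ℚ
Bernoulli m = nth (bernoulliList m) m

falling : ℤ → ℕ → ℤ
falling N zero    = + 1
falling N (suc h) = falling N h ℤ.* (N ℤ.- + h)

binomℤ : ℤ → ℕ → ℚ
binomℤ N h = _/_ (falling N h) (h !) {{h !≢0}}

-- Unsigned Stirling numbers of the first kind [n, m]:
-- coefficients of x(x+1)⋯(x+n-1) = Σ_m [n,m] x^m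
stirling1 : ℕ → ℕ → ℕ
stirling1 zero    zero    = 1
stirling1 zero    (suc m) = 0
stirling1 (suc n) zero    = 0
stirling1 (suc n) (suc m) = n ℕ.* stirling1 n (suc m) ℕ.+ stirling1 n m

-- 𝒜_{n,k} = Σ_{h ≥ 0} B_h binom(k+h-1, h) [n, h+k] n^h.
-- Terms with h > n vanish since [n, h+k] = 0 for h+k > n, so the sum over
-- h = 0 .. n is the full sum.
𝒜 : ℕ → ℕ → ℚ
𝒜 n k = Σ< (suc n) (λ h →
  Bernoulli h ℚ.* binomℤ ((+ (k ℕ.+ h)) ℤ.- + 1) h
    ℚ.* ℕ→ℚ (stirling1 n (h ℕ.+ k)) ℚ.* ℕ→ℚ (n ℕ.^ h))

{-# OPTIONS --safe #-}

-- Put a_s = 𝒜 n (s+1).  Then G(t) = Σ_s a_s tˢ is the image of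
-- f(t) = (t+1)⋯(t+n-1) under the operator nD/(eⁿᴰ - 1).
-- A prime p dividing n is harmless, because nʰ B_h is p-integral: its recurrence
-- involves only the p-integral quotients nˢ/(s+1).
-- For the other primes, put F(t) = t(t+1)⋯(t+n-1), so that F(t+1) - F(t) = n f(t).
-- All these operators commute and (1 + eᴰ + ⋯ + e⁽ⁿ⁻¹⁾ᴰ)(eᴰ - 1) = eⁿᴰ - 1, hence
-- n (G(t) + G(t+1) + ⋯ + G(t+n-1)) = n F′(t).  This system is triangular with diagonal
-- entries n², so each a_s becomes an integer after multiplication by a power of n.
module Submission where

open import Defs
open import Data.Nat as ℕ using (ℕ; zero; suc; _∸_; _!; _<_; _≤_; z≤n; s≤s)
import Data.Nat.Properties as ℕ
open import Data.Nat.Combinatorics using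
  (_C_; nCk≡n!/k![n-k]!; k>n⇒nCk≡0; nCk≡nC[n∸k]; nCn≡1; nC1≡n; k![n∸k]!∣n!;
   nCk+nC[k+1]≡[n+1]C[k+1])
open import Data.Nat.Coprimality as Coprimality using (Coprime)
open import Data.Nat.Divisibility using (_∣_; divides; ∣-trans)
open import Data.Nat.DivMod using (m/n*n≡m)
open import Data.Nat.GCD using (gcd; gcd[m,n]∣m; gcd[m,n]∣n; module Bézout)
open import Data.Nat.Induction using (<-rec)
open import Data.Nat.Tactic.RingSolver using () renaming (solve-∀ to ℕ-solve-∀)
open import Data.Integer as ℤ using (ℤ)
import Data.Integer.Properties as ℤ
open import Data.Rational using (ℚ; mkℚ; 0ℚ; 1ℚ; _+_; _*_; _-_; -_; _/_)
open import Data.Rational.Properties hiding (≤-refl)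
import Data.Rational.Unnormalised as ℚᵘ
import Data.Rational.Unnormalised.Properties as ℚᵘ
open import Data.List using (List; []; _∷_; _++_; length)
import Data.List.Properties as List
open import Data.Product using (Σ; _×_; _,_; ∃₂)
open import Data.Sum using (inj₁; inj₂)
open import Function using (_∘_)
open import Relation.Binary.PropositionalEquality
open import Relation.Nullary using (yes; no; contradiction)
open import Relation.Nullary.Decidable using (dec⇒maybe)
open import Tactic.RingSolver using (solve-∀)
open import Tactic.RingSolver.Core.AlmostCommutativeRing using (AlmostCommutativeRing; fromCommutativeRing)
open ≡-Reasoning

-- The terms of the sum over `h` are not integral one by one: a prime that does not divide `n` may
-- sit in the denominator of `B_h`, and the factor `n^h` cannot remove it. Only cancellation between
-- the terms helps there, which is why an identity for the whole polynomial `G` is needed.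
--
-- No prime occurs in the formal argument. Being integral at all primes dividing `n` is witnessed by
-- a multiplier coprime to `n` that makes the number an integer, and being integral at the other
-- primes by a multiplier that is a power of `n`. Two such multipliers are coprime, so Bézout gives
-- integrality. This also treats `n = 0` uniformly, since only 1 is coprime to 0.
--
-- Polynomials are sequences of coefficients, and a power series in `D` acts on them through
-- finitely many terms, up to a bound above the degree.
--
-- The index `k = 0` would be `s = -1`, outside the range of `G`. It is separate: `h - 1` over `h`
-- is zero for `h` positive, so a single term remains.

ℚ-ring : AlmostCommutativeRing _ _
ℚ-ring = fromCommutativeRing +-*-commutativeRing (λ x → dec⇒maybe (0ℚ ≟ x))

-- Integers inside the rationals

ι : ℤ → ℚ
ι z = z / 1

-- `z / 1` is stuck on a gcd when `z` is a variable. The explicit fraction lets sums and products of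
-- rationals compute.
ι≡mkℚ : ∀ z → ι z ≡ mkℚ z 0 (Coprimality.sym (Coprimality.1-coprimeTo _))
ι≡mkℚ z = ↥p/↧p≡p (mkℚ z 0 _)

ι-homo-+ : ∀ x y → ι (x ℤ.+ y) ≡ ι x + ι y
ι-homo-+ x y = begin
  ι (x ℤ.+ y)                        ≡⟨ cong₂ (λ u v → ι (u ℤ.+ v)) (ℤ.*-identityʳ x) (ℤ.*-identityʳ y) ⟨
  ι (x ℤ.* ℤ.+ 1 ℤ.+ y ℤ.* ℤ.+ 1)        ≡⟨ cong₂ _+_ (ι≡mkℚ x) (ι≡mkℚ y) ⟨
  ι x + ι y                          ∎

ι-homo-* : ∀ x y → ι (x ℤ.* y) ≡ ι x * ι y
ι-homo-* x y = cong₂ _*_ (sym (ι≡mkℚ x)) (sym (ι≡mkℚ y))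

ι-homo‿- : ∀ x → ι (ℤ.- x) ≡ - ι x
ι-homo‿- x = begin
  ι (ℤ.- x)                     ≡⟨ isolate (ι x) (ι (ℤ.- x)) ⟩
  (ι x + ι (ℤ.- x)) - ι x       ≡⟨ cong (_- ι x) (ι-homo-+ x (ℤ.- x)) ⟨
  ι (x ℤ.+ ℤ.- x) - ι x         ≡⟨ cong (λ z → ι z - ι x) (ℤ.+-inverseʳ x) ⟩
  0ℚ - ι x                      ≡⟨ +-identityˡ _ ⟩
  - ι x                         ∎
  where
  isolate : ∀ a b → b ≡ (a + b) - a
  isolate = solve-∀ ℚ-ring

-- `_/_` reduces by a gcd, so the identity is checked on unnormalised fractions, where it is a cross
-- multiplication.
d*[z/d]≡z : ∀ d .{{_ : ℕ.NonZero d}} z → ℕ→ℚ d * (z / d) ≡ ι z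
d*[z/d]≡z (suc d) z = toℚᵘ-injective (ℚᵘ.≃-trans (toℚᵘ-homo-* (ℕ→ℚ (suc d)) (z / suc d))
  (ℚᵘ.≃-trans
    (ℚᵘ.*-cong (toℚᵘ-fromℚᵘ (ℚᵘ.mkℚᵘ (ℤ.+ suc d) 0)) (toℚᵘ-fromℚᵘ (ℚᵘ.mkℚᵘ z d)))
    (ℚᵘ.≃-trans (ℚᵘ.*≡* cross-multiplied) (ℚᵘ.≃-sym (toℚᵘ-fromℚᵘ (ℚᵘ.mkℚᵘ z 0))))))
  where
  cross-multiplied : (ℤ.+ suc d ℤ.* z) ℤ.* ℤ.+ 1 ≡ z ℤ.* ℤ.+ suc (d ℕ.+ 0)
  cross-multiplied = begin
    (ℤ.+ suc d ℤ.* z) ℤ.* ℤ.+ 1  ≡⟨ ℤ.*-identityʳ (ℤ.+ suc d ℤ.* z) ⟩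
    ℤ.+ suc d ℤ.* z              ≡⟨ ℤ.*-comm (ℤ.+ suc d) z ⟩
    z ℤ.* ℤ.+ suc d              ≡⟨ cong (λ e → z ℤ.* ℤ.+ suc e) (ℕ.+-identityʳ d) ⟨
    z ℤ.* ℤ.+ suc (d ℕ.+ 0)      ∎

ℕ→ℚ-homo-+ : ∀ m n → ℕ→ℚ (m ℕ.+ n) ≡ ℕ→ℚ m + ℕ→ℚ n
ℕ→ℚ-homo-+ m n = ι-homo-+ (ℤ.+ m) (ℤ.+ n)

ℕ→ℚ-homo-* : ∀ m n → ℕ→ℚ (m ℕ.* n) ≡ ℕ→ℚ m * ℕ→ℚ n
ℕ→ℚ-homo-* m n = trans (cong ι (ℤ.pos-* m n)) (ι-homo-* (ℤ.+ m) (ℤ.+ n))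

ℕ→ℚ-cancelˡ : ∀ d .{{_ : ℕ.NonZero d}} {p q} → ℕ→ℚ d * p ≡ ℕ→ℚ d * q → p ≡ q
ℕ→ℚ-cancelˡ d {p} {q} eq = begin
  p                        ≡⟨ unit p ⟨
  1/d * (ℕ→ℚ d * p)        ≡⟨ cong (1/d *_) eq ⟩
  1/d * (ℕ→ℚ d * q)        ≡⟨ unit q ⟩
  q                        ∎
  where
  1/d = ℤ.+ 1 / d
  reassoc : ∀ x y z → x * (y * z) ≡ (y * x) * z
  reassoc = solve-∀ ℚ-ring
  unit : ∀ x → 1/d * (ℕ→ℚ d * x) ≡ x
  unit x = trans (reassoc 1/d (ℕ→ℚ d) x)
          (trans (cong (_* x) (d*[z/d]≡z d (ℤ.+ 1))) (*-identityˡ x))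

*-zero-congʳ : ∀ p {q} → q ≡ 0ℚ → p * q ≡ 0ℚ
*-zero-congʳ p refl = *-zeroʳ p

-- Finite sums

Σ-cong : ∀ m {f g} → (∀ i → i < m → f i ≡ g i) → Σ< m f ≡ Σ< m g
Σ-cong zero    eq = refl
Σ-cong (suc m) eq =
  cong₂ _+_ (Σ-cong m (λ i i<m → eq i (ℕ.m<n⇒m<1+n i<m))) (eq m ℕ.≤-refl)

Σ-zero : ∀ m {f} → (∀ i → i < m → f i ≡ 0ℚ) → Σ< m f ≡ 0ℚ
Σ-zero zero    eq = refl
Σ-zero (suc m) eq =
  cong₂ _+_ (Σ-zero m (λ i i<m → eq i (ℕ.m<n⇒m<1+n i<m))) (eq m ℕ.≤-refl)

Σ-distrib-+ : ∀ m f g → Σ< m (λ i → f i + g i) ≡ Σ< m f + Σ< m g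
Σ-distrib-+ zero    f g = refl
Σ-distrib-+ (suc m) f g =
  trans (cong (_+ (f m + g m)) (Σ-distrib-+ m f g)) (interchange (Σ< m f) (Σ< m g) (f m) (g m))
  where
  interchange : ∀ a b c d → (a + b) + (c + d) ≡ (a + c) + (b + d)
  interchange = solve-∀ ℚ-ring

*-distribˡ-Σ : ∀ m c f → c * Σ< m f ≡ Σ< m (λ i → c * f i)
*-distribˡ-Σ zero    c f = *-zeroʳ c
*-distribˡ-Σ (suc m) c f =
  trans (*-distribˡ-+ c (Σ< m f) (f m)) (cong (_+ c * f m) (*-distribˡ-Σ m c f))

*-distribʳ-Σ : ∀ m c f → Σ< m f * c ≡ Σ< m (λ i → f i * c)
*-distribʳ-Σ zero    c f = *-zeroˡ c
*-distribʳ-Σ (suc m) c f =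
  trans (*-distribʳ-+ c (Σ< m f) (f m)) (cong (_+ f m * c) (*-distribʳ-Σ m c f))

Σ-head : ∀ m f → Σ< (suc m) f ≡ f 0 + Σ< m (f ∘ suc)
Σ-head zero    f = +-comm 0ℚ (f 0)
Σ-head (suc m) f =
  trans (cong (_+ f (suc m)) (Σ-head m f)) (+-assoc (f 0) _ (f (suc m)))

Σ-swap : ∀ m n (f : ℕ → ℕ → ℚ) →
  Σ< m (λ i → Σ< n (f i)) ≡ Σ< n (λ j → Σ< m (λ i → f i j))
Σ-swap zero    n f = sym (Σ-zero n (λ _ _ → refl))
Σ-swap (suc m) n f =
  trans (cong (_+ Σ< n (f m)) (Σ-swap m n f))
        (sym (Σ-distrib-+ n (λ j → Σ< m (λ i → f i j)) (f m)))

-- Raising `m` by one appends one entry to each row, and the new entries form the antidiagonal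
-- `u = m`.
Σ-triangle : ∀ m (f : ℕ → ℕ → ℚ) →
  Σ< m (λ i → Σ< (m ∸ i) (f i)) ≡ Σ< m (λ u → Σ< (suc u) (λ i → f i (u ∸ i)))
Σ-triangle zero    f = refl
Σ-triangle (suc m) f = begin
  Σ< (suc m) (λ i → Σ< (suc m ∸ i) (f i))
    ≡⟨ Σ-cong (suc m) (λ i i<1+m →
         cong (λ k → Σ< k (f i)) (ℕ.+-∸-assoc 1 (ℕ.≤-pred i<1+m))) ⟩
  Σ< (suc m) (λ i → Σ< (m ∸ i) (f i) + f i (m ∸ i))
    ≡⟨ Σ-distrib-+ (suc m) _ _ ⟩
  (Σ< m (λ i → Σ< (m ∸ i) (f i)) + Σ< (m ∸ m) (f m)) + diagonal
    ≡⟨ cong (λ k → (Σ< m (λ i → Σ< (m ∸ i) (f i)) + Σ< k (f m)) + diagonal) (ℕ.n∸n≡0 m) ⟩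
  (Σ< m (λ i → Σ< (m ∸ i) (f i)) + 0ℚ) + diagonal
    ≡⟨ cong (_+ diagonal) (trans (+-identityʳ _) (Σ-triangle m f)) ⟩
  Σ< (suc m) (λ u → Σ< (suc u) (λ i → f i (u ∸ i))) ∎
  where diagonal = Σ< (suc m) (λ i → f i (m ∸ i))

Σ-truncate : ∀ {m n} f → n ≤ m → (∀ i → n ≤ i → f i ≡ 0ℚ) → Σ< m f ≡ Σ< n f
Σ-truncate {zero} f z≤n _ = refl
Σ-truncate {suc m} {n} f n≤1+m f≡0 with ℕ.m≤n⇒m<n∨m≡n n≤1+m
... | inj₂ refl = refl
... | inj₁ (s≤s n≤m) =
  trans (cong₂ _+_ (Σ-truncate f n≤m f≡0) (f≡0 m n≤m)) (+-identityʳ _)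

-- Identities between binomial coefficients

[m+n]Cn*[m!*n!]≡[m+n]! : ∀ m n → ((m ℕ.+ n) C n) ℕ.* (m ! ℕ.* n !) ≡ (m ℕ.+ n) !
[m+n]Cn*[m!*n!]≡[m+n]! m n = begin
  (k C n) ℕ.* (m ! ℕ.* n !)       ≡⟨ cong ((k C n) ℕ.*_) (ℕ.*-comm (m !) (n !)) ⟩
  (k C n) ℕ.* (n ! ℕ.* m !)       ≡⟨ cong (λ l → (k C n) ℕ.* (n ! ℕ.* l !)) (ℕ.m+n∸n≡m m n) ⟨
  (k C n) ℕ.* (n ! ℕ.* (k ∸ n) !) ≡⟨ cong (ℕ._* (n ! ℕ.* (k ∸ n) !)) (nCk≡n!/k![n-k]! n≤k) ⟩
  _                             ≡⟨ m/n*n≡m (k![n∸k]!∣n! n≤k) ⟩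
  k !                           ∎
  where
  k = m ℕ.+ n
  n≤k = ℕ.m≤n+m n m
  instance _ = n ℕ.!* (k ∸ n) !≢0

[m+n]Cm≡[m+n]Cn : ∀ m n → (m ℕ.+ n) C m ≡ (m ℕ.+ n) C n
[m+n]Cm≡[m+n]Cn m n =
  trans (nCk≡nC[n∸k] (ℕ.m≤m+n m n)) (cong ((m ℕ.+ n) C_) (ℕ.m+n∸m≡n m n))

[1+n]Cn≡1+n : ∀ n → suc n C n ≡ suc n
[1+n]Cn≡1+n n = trans
  (subst (λ k → k C n ≡ k C 1) (ℕ.+-comm n 1) ([m+n]Cm≡[m+n]Cn n 1)) (nC1≡n (suc n))

-- Both sides are the multinomial coefficient of `s`, `i`, `j`. This is the rule for composing
-- `D^i / i!` with `D^j / j!`.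
C-trinomial : ∀ s i j →
  ((s ℕ.+ i) C i) ℕ.* ((s ℕ.+ i ℕ.+ j) C j) ≡
  ((s ℕ.+ (i ℕ.+ j)) C (i ℕ.+ j)) ℕ.* ((i ℕ.+ j) C i)
C-trinomial s i j = ℕ.*-cancelʳ-≡ _ _ (s ! ℕ.* (i ! ℕ.* j !)) (begin
  a ℕ.* b ℕ.* (s ! ℕ.* (i ! ℕ.* j !))
    ≡⟨ regroupˡ a b (s !) (i !) (j !) ⟩
  b ℕ.* (a ℕ.* (s ! ℕ.* i !) ℕ.* j !)
    ≡⟨ cong (λ x → b ℕ.* (x ℕ.* j !)) ([m+n]Cn*[m!*n!]≡[m+n]! s i) ⟩
  b ℕ.* ((s ℕ.+ i) ! ℕ.* j !)
    ≡⟨ [m+n]Cn*[m!*n!]≡[m+n]! (s ℕ.+ i) j ⟩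
  (s ℕ.+ i ℕ.+ j) !
    ≡⟨ cong _! (ℕ.+-assoc s i j) ⟩
  (s ℕ.+ (i ℕ.+ j)) !
    ≡⟨ [m+n]Cn*[m!*n!]≡[m+n]! s (i ℕ.+ j) ⟨
  c ℕ.* (s ! ℕ.* (i ℕ.+ j) !)
    ≡⟨ cong (λ x → c ℕ.* (s ! ℕ.* x)) ([m+n]Cn*[m!*n!]≡[m+n]! i j) ⟨
  c ℕ.* (s ! ℕ.* (((i ℕ.+ j) C j) ℕ.* (i ! ℕ.* j !)))
    ≡⟨ cong (λ x → c ℕ.* (s ! ℕ.* (x ℕ.* (i ! ℕ.* j !)))) ([m+n]Cm≡[m+n]Cn i j) ⟨
  c ℕ.* (s ! ℕ.* (d ℕ.* (i ! ℕ.* j !)))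
    ≡⟨ regroupʳ c d (s !) (i ! ℕ.* j !) ⟩
  c ℕ.* d ℕ.* (s ! ℕ.* (i ! ℕ.* j !)) ∎)
  where
  a = (s ℕ.+ i) C i
  b = (s ℕ.+ i ℕ.+ j) C j
  c = (s ℕ.+ (i ℕ.+ j)) C (i ℕ.+ j)
  d = (i ℕ.+ j) C i
  instance _ = ℕ.m*n≢0 (s !) (i ! ℕ.* j !) {{s ℕ.!≢0}} {{i ℕ.!* j !≢0}}
  regroupˡ : ∀ a b s i j → a ℕ.* b ℕ.* (s ℕ.* (i ℕ.* j)) ≡ b ℕ.* (a ℕ.* (s ℕ.* i) ℕ.* j)
  regroupˡ = ℕ-solve-∀
  regroupʳ : ∀ c d s x → c ℕ.* (s ℕ.* (d ℕ.* x)) ≡ c ℕ.* d ℕ.* (s ℕ.* x)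
  regroupʳ = ℕ-solve-∀

-- Power series in D acting on polynomials

-- On coefficient sequences of polynomials c in t, this is the differential operator
-- Σ_i a_i D^i / i!.  The bound M only has to exceed the degree of c.
act : ℕ → (ℕ → ℚ) → (ℕ → ℚ) → ℕ → ℚ
act M a c s = Σ< M (λ i → ℕ→ℚ ((s ℕ.+ i) C i) * a i * c (s ℕ.+ i))

-- Because `act` divides by `i!`, sequences multiply as exponential generating functions in `D`.
_⋆_ : (ℕ → ℚ) → (ℕ → ℚ) → ℕ → ℚ
(a ⋆ b) u = Σ< (suc u) (λ i → ℕ→ℚ (u C i) * a i * b (u ∸ i))

act-congʳ : ∀ M a {b c} → (∀ s → b s ≡ c s) → ∀ s → act M a b s ≡ act M a c s
act-congʳ M a eq s =
  Σ-cong M (λ i _ → cong (ℕ→ℚ ((s ℕ.+ i) C i) * a i *_) (eq (s ℕ.+ i)))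

act-congˡ : ∀ M {a b} c → (∀ i → a i ≡ b i) → ∀ s → act M a c s ≡ act M b c s
act-congˡ M c eq s =
  Σ-cong M (λ i _ → cong (λ x → ℕ→ℚ ((s ℕ.+ i) C i) * x * c (s ℕ.+ i)) (eq i))

act-scale : ∀ M a x c s → act M a (λ r → x * c r) s ≡ x * act M a c s
act-scale M a x c s =
  trans (Σ-cong M (λ i _ → rearrange (ℕ→ℚ ((s ℕ.+ i) C i) * a i) x (c (s ℕ.+ i))))
        (sym (*-distribˡ-Σ M x (λ i → ℕ→ℚ ((s ℕ.+ i) C i) * a i * c (s ℕ.+ i))))
  where
  rearrange : ∀ p x y → p * (x * y) ≡ x * (p * y)
  rearrange = solve-∀ ℚ-ring

act∘act : ∀ M a b c s → act M a (act M b c) s ≡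
  Σ< M (λ i → Σ< M (λ j → ℕ→ℚ ((s ℕ.+ (i ℕ.+ j)) C (i ℕ.+ j))
    * (ℕ→ℚ ((i ℕ.+ j) C i) * a i * b j) * c (s ℕ.+ (i ℕ.+ j))))
act∘act M a b c s = Σ-cong M λ i _ →
  trans (*-distribˡ-Σ M (ℕ→ℚ ((s ℕ.+ i) C i) * a i)
          (λ j → ℕ→ℚ ((s ℕ.+ i ℕ.+ j) C j) * b j * c (s ℕ.+ i ℕ.+ j)))
        (Σ-cong M λ j _ → begin
    ℕ→ℚ ((s ℕ.+ i) C i) * a i * (ℕ→ℚ ((s ℕ.+ i ℕ.+ j) C j) * b j * c (s ℕ.+ i ℕ.+ j))
      ≡⟨ gather (ℕ→ℚ ((s ℕ.+ i) C i)) (a i) (ℕ→ℚ ((s ℕ.+ i ℕ.+ j) C j)) (b j) (c (s ℕ.+ i ℕ.+ j)) ⟩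
    (ℕ→ℚ ((s ℕ.+ i) C i) * ℕ→ℚ ((s ℕ.+ i ℕ.+ j) C j)) * (a i * b j) * c (s ℕ.+ i ℕ.+ j)
      ≡⟨ cong₂ (λ x k → x * (a i * b j) * c k) (trinomial i j) (ℕ.+-assoc s i j) ⟩
    (ℕ→ℚ ((s ℕ.+ (i ℕ.+ j)) C (i ℕ.+ j)) * ℕ→ℚ ((i ℕ.+ j) C i)) * (a i * b j) * c (s ℕ.+ (i ℕ.+ j))
      ≡⟨ regroup (ℕ→ℚ ((s ℕ.+ (i ℕ.+ j)) C (i ℕ.+ j))) (ℕ→ℚ ((i ℕ.+ j) C i)) (a i) (b j) (c (s ℕ.+ (i ℕ.+ j))) ⟩
    ℕ→ℚ ((s ℕ.+ (i ℕ.+ j)) C (i ℕ.+ j)) * (ℕ→ℚ ((i ℕ.+ j) C i) * a i * b j) * c (s ℕ.+ (i ℕ.+ j)) ∎)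
  where
  gather : ∀ p a q b c → p * a * (q * b * c) ≡ (p * q) * (a * b) * c
  gather = solve-∀ ℚ-ring
  regroup : ∀ p q a b c → (p * q) * (a * b) * c ≡ p * (q * a * b) * c
  regroup = solve-∀ ℚ-ring
  trinomial : ∀ i j → ℕ→ℚ ((s ℕ.+ i) C i) * ℕ→ℚ ((s ℕ.+ i ℕ.+ j) C j) ≡
                      ℕ→ℚ ((s ℕ.+ (i ℕ.+ j)) C (i ℕ.+ j)) * ℕ→ℚ ((i ℕ.+ j) C i)
  trinomial i j = trans (sym (ℕ→ℚ-homo-* ((s ℕ.+ i) C i) _))
    (trans (cong ℕ→ℚ (C-trinomial s i j)) (ℕ→ℚ-homo-* ((s ℕ.+ (i ℕ.+ j)) C (i ℕ.+ j)) _))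

-- Both operators are cut off at the same `M`, so the pairs `(i , j)` fill a square, which
-- exchanging the indices preserves.
act-comm : ∀ M a b c s → act M a (act M b c) s ≡ act M b (act M a c) s
act-comm M a b c s = begin
  act M a (act M b c) s
    ≡⟨ act∘act M a b c s ⟩
  _ ≡⟨ Σ-swap M M _ ⟩
  _ ≡⟨ Σ-cong M (λ j _ → Σ-cong M (λ i _ → cong₂ (λ k x →
         ℕ→ℚ ((s ℕ.+ k) C k) * x * c (s ℕ.+ k)) (ℕ.+-comm i j) (symmetric i j))) ⟩
  _ ≡⟨ act∘act M b a c s ⟨
  act M b (act M a c) s ∎
  where
  exchange : ∀ p x y → p * x * y ≡ p * y * x
  exchange = solve-∀ ℚ-ring
  symmetric : ∀ i j → ℕ→ℚ ((i ℕ.+ j) C i) * a i * b j ≡ ℕ→ℚ ((j ℕ.+ i) C j) * b j * a i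
  symmetric i j = trans (exchange (ℕ→ℚ ((i ℕ.+ j) C i)) (a i) (b j)) (cong (λ x → ℕ→ℚ x * b j * a i)
    (trans ([m+n]Cm≡[m+n]Cn i j) (cong (_C j) (ℕ.+-comm i j))))

-- The square of pairs exceeds the triangle `i + j < M` only by terms in which `c` is zero.
-- Collecting the triangle by `u = i + j` gives the coefficients of `a ⋆ b`.
act-⋆ : ∀ M a b c → (∀ r → M ≤ r → c r ≡ 0ℚ) →
  ∀ s → act M a (act M b c) s ≡ act M (a ⋆ b) c s
act-⋆ M a b c c≡0 s = begin
  act M a (act M b c) s
    ≡⟨ act∘act M a b c s ⟩
  Σ< M (λ i → Σ< M (term i))
    ≡⟨ Σ-cong M (λ i i<M → Σ-truncate (term i) (ℕ.m∸n≤m M i) (λ j M∸i≤j →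
         *-zero-congʳ (coeff i j) (c≡0 _ (ℕ.≤-trans (ℕ.m≤n+m∸n M i)
           (ℕ.≤-trans (ℕ.+-monoʳ-≤ i M∸i≤j) (ℕ.m≤n+m _ s)))))) ⟩
  Σ< M (λ i → Σ< (M ∸ i) (term i))
    ≡⟨ Σ-triangle M term ⟩
  Σ< M (λ u → Σ< (suc u) (λ i → term i (u ∸ i)))
    ≡⟨ Σ-cong M (λ u _ → Σ-cong (suc u) (λ i i<1+u →
         cong (λ k → ℕ→ℚ ((s ℕ.+ k) C k) * (ℕ→ℚ (k C i) * a i * b (u ∸ i)) * c (s ℕ.+ k))
              (ℕ.m+[n∸m]≡n (ℕ.≤-pred i<1+u)))) ⟩
  _ ≡⟨ Σ-cong M (λ u _ → trans
         (sym (*-distribʳ-Σ (suc u) (c (s ℕ.+ u))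
                (λ i → ℕ→ℚ ((s ℕ.+ u) C u) * (ℕ→ℚ (u C i) * a i * b (u ∸ i)))))
         (cong (_* c (s ℕ.+ u)) (sym (*-distribˡ-Σ (suc u) (ℕ→ℚ ((s ℕ.+ u) C u))
                (λ i → ℕ→ℚ (u C i) * a i * b (u ∸ i)))))) ⟩
  act M (a ⋆ b) c s ∎
  where
  coeff term : ℕ → ℕ → ℚ
  coeff i j = ℕ→ℚ ((s ℕ.+ (i ℕ.+ j)) C (i ℕ.+ j)) * (ℕ→ℚ ((i ℕ.+ j) C i) * a i * b j)
  term i j = coeff i j * c (s ℕ.+ (i ℕ.+ j))

-- Stirling numbers under the translation t ↦ t + 1

C-pascal : ∀ u k → ℕ→ℚ (suc u C suc k) ≡ ℕ→ℚ (u C k) + ℕ→ℚ (u C suc k)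
C-pascal u k = trans (cong ℕ→ℚ (sym (nCk+nC[k+1]≡[n+1]C[k+1] u k)))
                     (ℕ→ℚ-homo-+ (u C k) (u C suc k))

stirling1-vanishes : ∀ {n m} → n < m → stirling1 n m ≡ 0
stirling1-vanishes {zero}  {suc m} _ = refl
stirling1-vanishes {suc n} {suc m} (s≤s n<m) = begin
  n ℕ.* stirling1 n (suc m) ℕ.+ stirling1 n m
    ≡⟨ cong₂ (λ x y → n ℕ.* x ℕ.+ y)
         (stirling1-vanishes (ℕ.m<n⇒m<1+n n<m)) (stirling1-vanishes n<m) ⟩
  n ℕ.* 0 ℕ.+ 0
    ≡⟨ cong (ℕ._+ 0) (ℕ.*-zeroʳ n) ⟩
  0 ∎

stirling : ℕ → ℕ → ℚ
stirling n m = ℕ→ℚ (stirling1 n m)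

stirling-suc : ∀ n m → stirling (suc n) (suc m) ≡ ℕ→ℚ n * stirling n (suc m) + stirling n m
stirling-suc n m = trans (ℕ→ℚ-homo-+ (n ℕ.* stirling1 n (suc m)) (stirling1 n m))
  (cong (_+ stirling n m) (ℕ→ℚ-homo-* n (stirling1 n (suc m))))

stirling-suc-zero : ∀ n → stirling (suc n) 0 ≡ ℕ→ℚ n * stirling n 0
stirling-suc-zero zero    = refl
stirling-suc-zero (suc n) = sym (*-zeroʳ (ℕ→ℚ (suc n)))

private
  shift : ℕ → ℕ → ℕ → ℚ
  shift n s M = Σ< M (λ i → ℕ→ℚ ((s ℕ.+ i) C i) * stirling n (s ℕ.+ i))

-- With `F_n(t) = t(t+1)⋯(t+n-1)`, the sum is coefficient `s` of `F_n(t+1)`, and the identity says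
-- `t F_n(t+1) = F_{n+1}(t)`. The induction uses `F_{n+1}(t+1) = (t+1+n) F_n(t+1)`.
stirling-shift : ∀ n s {M} → n < M →
  Σ< M (λ i → ℕ→ℚ ((s ℕ.+ i) C i) * stirling n (s ℕ.+ i)) ≡ stirling (suc n) (suc s)
stirling-shift zero zero {suc M} _ = begin
  shift 0 0 (suc M)
    ≡⟨ Σ-head M _ ⟩
  1ℚ * 1ℚ + Σ< M (λ i → ℕ→ℚ (suc i C suc i) * 0ℚ)
    ≡⟨ cong (λ x → 1ℚ * 1ℚ + x) (Σ-zero M (λ i _ → *-zeroʳ (ℕ→ℚ (suc i C suc i)))) ⟩
  1ℚ ∎
stirling-shift zero (suc s) {M} _ =
  Σ-zero M (λ i _ → *-zeroʳ (ℕ→ℚ ((suc s ℕ.+ i) C i)))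
stirling-shift (suc n) zero {suc M} (s≤s n<M) = begin
  shift (suc n) 0 (suc M)
    ≡⟨ Σ-head M (λ i → ℕ→ℚ (i C i) * stirling (suc n) i) ⟩
  1ℚ * stirling (suc n) 0 + Σ< M (λ i → ℕ→ℚ (suc i C suc i) * stirling (suc n) (suc i))
    ≡⟨ cong₂ (λ x y → 1ℚ * x + y) (stirling-suc-zero n)
         (trans (Σ-cong M (λ i _ → trans
           (cong (ℕ→ℚ (suc i C suc i) *_) (stirling-suc n i))
           (trans (expand (ℕ→ℚ (suc i C suc i)) (ℕ→ℚ n) (stirling n (suc i)) (stirling n i))
             (cong (λ k → ℕ→ℚ n * (ℕ→ℚ (suc i C suc i) * stirling n (suc i)) + ℕ→ℚ k * stirling n i)
               (trans (nCn≡1 (suc i)) (sym (nCn≡1 i)))))))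
          (trans (Σ-distrib-+ M (λ i → ℕ→ℚ n * (ℕ→ℚ (suc i C suc i) * stirling n (suc i)))
                                (λ i → ℕ→ℚ (i C i) * stirling n i))
            (cong (_+ shift n 0 M)
              (sym (*-distribˡ-Σ M (ℕ→ℚ n) (λ i → ℕ→ℚ (suc i C suc i) * stirling n (suc i))))))) ⟩
  1ℚ * (ℕ→ℚ n * stirling n 0) + (ℕ→ℚ n * tail + shift n 0 M)
    ≡⟨ collect (ℕ→ℚ n) (stirling n 0) tail (shift n 0 M) ⟩
  ℕ→ℚ n * (1ℚ * stirling n 0 + tail) + shift n 0 M
    ≡⟨ cong (λ x → ℕ→ℚ n * x + shift n 0 M) (Σ-head M (λ i → ℕ→ℚ (i C i) * stirling n i)) ⟨
  ℕ→ℚ n * shift n 0 (suc M) + shift n 0 M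
    ≡⟨ cong₂ (λ x y → ℕ→ℚ n * x + y)
         (stirling-shift n 0 (ℕ.m<n⇒m<1+n n<M)) (stirling-shift n 0 n<M) ⟩
  ℕ→ℚ n * stirling (suc n) 1 + stirling (suc n) 1
    -- The added `0ℚ` is `stirling (suc n) 0`, the second term that the recurrence expects.
    ≡⟨ absorb (ℕ→ℚ n) (stirling (suc n) 1) 0ℚ ⟩
  (1ℚ + ℕ→ℚ n) * stirling (suc n) 1 + 0ℚ
    ≡⟨ cong (λ x → x * stirling (suc n) 1 + 0ℚ) (ℕ→ℚ-homo-+ 1 n) ⟨
  ℕ→ℚ (suc n) * stirling (suc n) 1 + stirling (suc n) 0
    ≡⟨ stirling-suc (suc n) 0 ⟨
  stirling (suc (suc n)) 1 ∎
  where
  tail = Σ< M (λ i → ℕ→ℚ (suc i C suc i) * stirling n (suc i))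
  expand : ∀ c x y z → c * (x * y + z) ≡ x * (c * y) + c * z
  expand = solve-∀ ℚ-ring
  collect : ∀ x y t z → 1ℚ * (x * y) + (x * t + z) ≡ x * (1ℚ * y + t) + z
  collect = solve-∀ ℚ-ring
  absorb : ∀ x y z → x * y + y ≡ (1ℚ + x) * y + 0ℚ
  absorb = solve-∀ ℚ-ring
stirling-shift (suc n) (suc s) {suc M} (s≤s n<M) = begin
  shift (suc n) (suc s) (suc M)
    ≡⟨ Σ-cong (suc M) (λ i _ → trans
         (cong (ℕ→ℚ ((suc s ℕ.+ i) C i) *_) (stirling-suc n (s ℕ.+ i)))
         (expand (ℕ→ℚ ((suc s ℕ.+ i) C i)) (ℕ→ℚ n) (stirling n (suc s ℕ.+ i)) (stirling n (s ℕ.+ i)))) ⟩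
  Σ< (suc M) (λ i → ℕ→ℚ n * (ℕ→ℚ ((suc s ℕ.+ i) C i) * stirling n (suc s ℕ.+ i)) + lower i)
    ≡⟨ Σ-distrib-+ (suc M) (λ i → ℕ→ℚ n * (ℕ→ℚ ((suc s ℕ.+ i) C i) * stirling n (suc s ℕ.+ i))) lower ⟩
  Σ< (suc M) (λ i → ℕ→ℚ n * (ℕ→ℚ ((suc s ℕ.+ i) C i) * stirling n (suc s ℕ.+ i))) + Σ< (suc M) lower
    ≡⟨ cong₂ _+_
         (sym (*-distribˡ-Σ (suc M) (ℕ→ℚ n) (λ i → ℕ→ℚ ((suc s ℕ.+ i) C i) * stirling n (suc s ℕ.+ i))))
         Σ-lower ⟩
  ℕ→ℚ n * shift n (suc s) (suc M) + (shift n s (suc M) + shift n (suc s) M)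
    ≡⟨ cong₂ (λ x y → ℕ→ℚ n * x + y) (stirling-shift n (suc s) (ℕ.m<n⇒m<1+n n<M))
         (cong₂ _+_ (stirling-shift n s (ℕ.m<n⇒m<1+n n<M)) (stirling-shift n (suc s) n<M)) ⟩
  ℕ→ℚ n * stirling (suc n) (suc (suc s)) + (stirling (suc n) (suc s) + stirling (suc n) (suc (suc s)))
    ≡⟨ absorb (ℕ→ℚ n) (stirling (suc n) (suc (suc s))) (stirling (suc n) (suc s)) ⟩
  (1ℚ + ℕ→ℚ n) * stirling (suc n) (suc (suc s)) + stirling (suc n) (suc s)
    ≡⟨ cong (λ x → x * stirling (suc n) (suc (suc s)) + stirling (suc n) (suc s)) (ℕ→ℚ-homo-+ 1 n) ⟨
  ℕ→ℚ (suc n) * stirling (suc n) (suc (suc s)) + stirling (suc n) (suc s)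
    ≡⟨ stirling-suc (suc n) (suc s) ⟨
  stirling (suc (suc n)) (suc (suc s)) ∎
  where
  lower : ℕ → ℚ
  lower i = ℕ→ℚ ((suc s ℕ.+ i) C i) * stirling n (s ℕ.+ i)
  expand : ∀ c x y z → c * (x * y + z) ≡ x * (c * y) + c * z
  expand = solve-∀ ℚ-ring
  absorb : ∀ x y z → x * y + (z + y) ≡ (1ℚ + x) * y + z
  absorb = solve-∀ ℚ-ring
  regroup : ∀ h p q → h + (p + q) ≡ (h + q) + p
  regroup = solve-∀ ℚ-ring
  upper : ℕ → ℚ
  upper i = ℕ→ℚ ((s ℕ.+ suc i) C i) * stirling n (s ℕ.+ suc i)
  rest : ℕ → ℚ
  rest i = ℕ→ℚ ((s ℕ.+ suc i) C suc i) * stirling n (s ℕ.+ suc i)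
  -- Pascal's rule is here multiplication by `t + 1`: the left side is coefficient `s + 1` of
  -- `(t+1) F_n(t+1)`. The second sum loses one index, but its range `M` still exceeds the degree
  -- `n`.
  Σ-lower : Σ< (suc M) lower ≡ shift n s (suc M) + shift n (suc s) M
  Σ-lower = begin
    Σ< (suc M) lower
      ≡⟨ Σ-head M lower ⟩
    lower 0 + Σ< M (lower ∘ suc)
      ≡⟨ cong (lower 0 +_) (trans (Σ-cong M (λ i _ → trans
           (cong (_* stirling n (s ℕ.+ suc i)) (C-pascal (s ℕ.+ suc i) i))
           (*-distribʳ-+ (stirling n (s ℕ.+ suc i)) (ℕ→ℚ ((s ℕ.+ suc i) C i)) (ℕ→ℚ ((s ℕ.+ suc i) C suc i)))))
         (Σ-distrib-+ M upper rest)) ⟩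
    lower 0 + (Σ< M upper + Σ< M rest)
      ≡⟨ regroup (lower 0) (Σ< M upper) (Σ< M rest) ⟩
    (lower 0 + Σ< M rest) + Σ< M upper
      ≡⟨ cong₂ _+_ (sym (Σ-head M (λ i → ℕ→ℚ ((s ℕ.+ i) C i) * stirling n (s ℕ.+ i))))
           (Σ-cong M (λ i _ → cong (λ k → ℕ→ℚ (k C i) * stirling n k) (ℕ.+-suc s i))) ⟩
    shift n s (suc M) + shift n (suc s) M ∎

-- Difference operators and power sums

-- act M (diff m) is the difference operator c(t) ↦ c(t+m) − c(t).
diff : ℕ → ℕ → ℚ
diff m zero    = 0ℚ
diff m (suc u) = ℕ→ℚ (m ℕ.^ suc u)

-- Compare the coefficients of `t^(s+1)` in `t F(t+1) = (t+n) F(t)`.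
diff-1-stirling : ∀ n s →
  act (suc n) (diff 1) (stirling n) s ≡ ℕ→ℚ n * stirling n (suc s)
diff-1-stirling n s = begin
  act (suc n) (diff 1) (stirling n) s
    ≡⟨ Σ-head n (λ i → ℕ→ℚ ((s ℕ.+ i) C i) * diff 1 i * stirling n (s ℕ.+ i)) ⟩
  1ℚ * 0ℚ * stirling n (s ℕ.+ 0) + Σ< n (λ i → ℕ→ℚ ((s ℕ.+ suc i) C suc i) * ℕ→ℚ (1 ℕ.^ suc i) * stirling n (s ℕ.+ suc i))
    ≡⟨ cong (λ x → 1ℚ * 0ℚ * stirling n (s ℕ.+ 0) + x) (Σ-cong n (λ i _ →
         cong (_* stirling n (s ℕ.+ suc i))
           (trans (cong (λ k → ℕ→ℚ ((s ℕ.+ suc i) C suc i) * ℕ→ℚ k) (ℕ.^-zeroˡ (suc i))) (*-identityʳ (ℕ→ℚ ((s ℕ.+ suc i) C suc i)))))) ⟩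
  1ℚ * 0ℚ * stirling n (s ℕ.+ 0) + tail
    -- `diff 1` is zero at index 0; adding and subtracting that term completes the sum to a full
    -- translation.
    ≡⟨ complete (stirling n (s ℕ.+ 0)) tail ⟩
  (1ℚ * stirling n (s ℕ.+ 0) + tail) - stirling n (s ℕ.+ 0)
    ≡⟨ cong₂ _-_ (sym (Σ-head n (λ i → ℕ→ℚ ((s ℕ.+ i) C i) * stirling n (s ℕ.+ i))))
         (cong (stirling n) (ℕ.+-identityʳ s)) ⟩
  Σ< (suc n) (λ i → ℕ→ℚ ((s ℕ.+ i) C i) * stirling n (s ℕ.+ i)) - stirling n s
    ≡⟨ cong (_- stirling n s) (trans (stirling-shift n s ℕ.≤-refl) (stirling-suc n s)) ⟩
  (ℕ→ℚ n * stirling n (suc s) + stirling n s) - stirling n s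
    ≡⟨ cancel (ℕ→ℚ n * stirling n (suc s)) (stirling n s) ⟩
  ℕ→ℚ n * stirling n (suc s) ∎
  where
  tail = Σ< n (λ i → ℕ→ℚ ((s ℕ.+ suc i) C suc i) * stirling n (s ℕ.+ suc i))
  complete : ∀ x t → 1ℚ * 0ℚ * x + t ≡ (1ℚ * x + t) - x
  complete = solve-∀ ℚ-ring
  cancel : ∀ x y → (x + y) - y ≡ x
  cancel = solve-∀ ℚ-ring

⋆-diff : ∀ a m u →
  (a ⋆ diff m) u ≡ Σ< u (λ i → ℕ→ℚ (u C i) * a i * ℕ→ℚ (m ℕ.^ (u ∸ i)))
⋆-diff a m u = begin
  Σ< u (λ i → ℕ→ℚ (u C i) * a i * diff m (u ∸ i)) + ℕ→ℚ (u C u) * a u * diff m (u ∸ u)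
    ≡⟨ cong₂ _+_
         (Σ-cong u (λ i i<u → cong (ℕ→ℚ (u C i) * a i *_) (diff-pos i i<u)))
         (*-zero-congʳ (ℕ→ℚ (u C u) * a u) (cong (diff m) (ℕ.n∸n≡0 u))) ⟩
  Σ< u (λ i → ℕ→ℚ (u C i) * a i * ℕ→ℚ (m ℕ.^ (u ∸ i))) + 0ℚ
    ≡⟨ +-identityʳ _ ⟩
  Σ< u (λ i → ℕ→ℚ (u C i) * a i * ℕ→ℚ (m ℕ.^ (u ∸ i))) ∎
  where
  diff-pos : ∀ i → i < u → diff m (u ∸ i) ≡ ℕ→ℚ (m ℕ.^ (u ∸ i))
  diff-pos i i<u with u ∸ i | ℕ.m<n⇒0<n∸m i<u
  ... | suc _ | _ = refl

binomial : ∀ j u → Σ< (suc u) (λ i → ℕ→ℚ (u C i) * ℕ→ℚ (j ℕ.^ i)) ≡ ℕ→ℚ (suc j ℕ.^ u)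
binomial j zero    = refl
binomial j (suc u) = begin
  Σ< (suc (suc u)) (λ i → ℕ→ℚ (suc u C i) * ℕ→ℚ (j ℕ.^ i))
    ≡⟨ Σ-head (suc u) (λ i → ℕ→ℚ (suc u C i) * ℕ→ℚ (j ℕ.^ i)) ⟩
  1ℚ * 1ℚ + Σ< (suc u) (λ i → ℕ→ℚ (suc u C suc i) * ℕ→ℚ (j ℕ.^ suc i))
    ≡⟨ cong (λ x → 1ℚ * 1ℚ + x) (trans (Σ-cong (suc u) (λ i _ → split i))
         (Σ-distrib-+ (suc u) (λ i → ℕ→ℚ j * (ℕ→ℚ (u C i) * ℕ→ℚ (j ℕ.^ i))) (term ∘ suc))) ⟩
  1ℚ * 1ℚ + (Σ< (suc u) (λ i → ℕ→ℚ j * (ℕ→ℚ (u C i) * ℕ→ℚ (j ℕ.^ i))) + Σ< (suc u) (term ∘ suc))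
    ≡⟨ cong₂ (λ x y → 1ℚ * 1ℚ + (x + y))
         (trans (sym (*-distribˡ-Σ (suc u) (ℕ→ℚ j) term)) (cong (ℕ→ℚ j *_) (binomial j u)))
         Σ-tail ⟩
  1ℚ * 1ℚ + (ℕ→ℚ j * ℕ→ℚ (suc j ℕ.^ u) + (ℕ→ℚ (suc j ℕ.^ u) - 1ℚ))
    ≡⟨ collect (ℕ→ℚ j) (ℕ→ℚ (suc j ℕ.^ u)) ⟩
  ℕ→ℚ (suc j ℕ.^ u) + ℕ→ℚ j * ℕ→ℚ (suc j ℕ.^ u)
    ≡⟨ cong (ℕ→ℚ (suc j ℕ.^ u) +_) (ℕ→ℚ-homo-* j (suc j ℕ.^ u)) ⟨
  ℕ→ℚ (suc j ℕ.^ u) + ℕ→ℚ (j ℕ.* suc j ℕ.^ u)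
    ≡⟨ ℕ→ℚ-homo-+ (suc j ℕ.^ u) (j ℕ.* suc j ℕ.^ u) ⟨
  ℕ→ℚ (suc j ℕ.^ suc u) ∎
  where
  term : ℕ → ℚ
  term i = ℕ→ℚ (u C i) * ℕ→ℚ (j ℕ.^ i)
  expand : ∀ p q x y → (p + q) * (x * y) ≡ x * (p * y) + q * (x * y)
  expand = solve-∀ ℚ-ring
  split : ∀ i → ℕ→ℚ (suc u C suc i) * ℕ→ℚ (j ℕ.^ suc i) ≡ ℕ→ℚ j * term i + term (suc i)
  split i = begin
    ℕ→ℚ (suc u C suc i) * ℕ→ℚ (j ℕ.^ suc i)
      ≡⟨ cong₂ _*_ (C-pascal u i) (ℕ→ℚ-homo-* j (j ℕ.^ i)) ⟩
    (ℕ→ℚ (u C i) + ℕ→ℚ (u C suc i)) * (ℕ→ℚ j * ℕ→ℚ (j ℕ.^ i))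
      ≡⟨ expand (ℕ→ℚ (u C i)) (ℕ→ℚ (u C suc i)) (ℕ→ℚ j) (ℕ→ℚ (j ℕ.^ i)) ⟩
    ℕ→ℚ j * term i + ℕ→ℚ (u C suc i) * (ℕ→ℚ j * ℕ→ℚ (j ℕ.^ i))
      ≡⟨ cong (λ x → ℕ→ℚ j * term i + ℕ→ℚ (u C suc i) * x) (ℕ→ℚ-homo-* j (j ℕ.^ i)) ⟨
    ℕ→ℚ j * term i + term (suc i) ∎
  isolate : ∀ x → x ≡ (1ℚ * 1ℚ + x) - 1ℚ
  isolate = solve-∀ ℚ-ring
  Σ-tail : Σ< (suc u) (term ∘ suc) ≡ ℕ→ℚ (suc j ℕ.^ u) - 1ℚ
  Σ-tail = begin
    Σ< (suc u) (term ∘ suc)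
      ≡⟨ Σ-truncate (term ∘ suc) (ℕ.n≤1+n u) (λ i u≤i →
           trans (cong (λ k → ℕ→ℚ k * ℕ→ℚ (j ℕ.^ suc i)) (k>n⇒nCk≡0 (s≤s u≤i)))
                 (*-zeroˡ (ℕ→ℚ (j ℕ.^ suc i)))) ⟩
    Σ< u (term ∘ suc)
      ≡⟨ isolate (Σ< u (term ∘ suc)) ⟩
    (1ℚ * 1ℚ + Σ< u (term ∘ suc)) - 1ℚ
      ≡⟨ cong (_- 1ℚ) (trans (sym (Σ-head u term)) (binomial j u)) ⟩
    ℕ→ℚ (suc j ℕ.^ u) - 1ℚ ∎
  collect : ∀ x y → 1ℚ * 1ℚ + (x * y + (y - 1ℚ)) ≡ y + x * y
  collect = solve-∀ ℚ-ring

-- act M (powerSum n) is the operator c(t) ↦ c(t) + c(t+1) + ⋯ + c(t+n-1).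
powerSum : ℕ → ℕ → ℚ
powerSum n i = Σ< n (λ j → ℕ→ℚ (j ℕ.^ i))

powerSum-zero : ∀ n → powerSum n 0 ≡ ℕ→ℚ n
powerSum-zero zero    = refl
powerSum-zero (suc n) = begin
  powerSum n 0 + 1ℚ  ≡⟨ cong (_+ 1ℚ) (powerSum-zero n) ⟩
  ℕ→ℚ n + ℕ→ℚ 1      ≡⟨ ℕ→ℚ-homo-+ n 1 ⟨
  ℕ→ℚ (n ℕ.+ 1)      ≡⟨ cong ℕ→ℚ (ℕ.+-comm n 1) ⟩
  ℕ→ℚ (suc n)        ∎

-- After exchanging the sums, each `j` contributes the binomial expansion of `(j+1)^(u+1)` without
-- its top term `j^(u+1)`. These differences telescope.
powerSum-⋆-diff : ∀ n u → (powerSum n ⋆ diff 1) u ≡ diff n u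
powerSum-⋆-diff n zero    = cong (λ x → 0ℚ + x) (*-zeroʳ (1ℚ * powerSum n 0))
powerSum-⋆-diff n (suc u) = begin
  (powerSum n ⋆ diff 1) (suc u)
    ≡⟨ ⋆-diff (powerSum n) 1 (suc u) ⟩
  Σ< (suc u) (λ i → ℕ→ℚ (suc u C i) * powerSum n i * ℕ→ℚ (1 ℕ.^ (suc u ∸ i)))
    ≡⟨ Σ-cong (suc u) (λ i _ → trans
         (cong (λ k → ℕ→ℚ (suc u C i) * powerSum n i * ℕ→ℚ k) (ℕ.^-zeroˡ (suc u ∸ i)))
         (trans (*-identityʳ (ℕ→ℚ (suc u C i) * powerSum n i))
                (*-distribˡ-Σ n (ℕ→ℚ (suc u C i)) (λ j → ℕ→ℚ (j ℕ.^ i))))) ⟩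
  Σ< (suc u) (λ i → Σ< n (λ j → ℕ→ℚ (suc u C i) * ℕ→ℚ (j ℕ.^ i)))
    ≡⟨ Σ-swap (suc u) n (λ i j → ℕ→ℚ (suc u C i) * ℕ→ℚ (j ℕ.^ i)) ⟩
  Σ< n increment
    ≡⟨ telescope n ⟩
  ℕ→ℚ (n ℕ.^ suc u) ∎
  where
  increment : ℕ → ℚ
  increment j = Σ< (suc u) (λ i → ℕ→ℚ (suc u C i) * ℕ→ℚ (j ℕ.^ i))
  swap-unit : ∀ x y → y + x ≡ x + 1ℚ * y
  swap-unit = solve-∀ ℚ-ring
  telescope : ∀ m → Σ< m increment ≡ ℕ→ℚ (m ℕ.^ suc u)
  telescope zero    = refl
  telescope (suc m) = begin
    Σ< m increment + increment m
      ≡⟨ cong (_+ increment m) (telescope m) ⟩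
    ℕ→ℚ (m ℕ.^ suc u) + increment m
      ≡⟨ swap-unit (increment m) (ℕ→ℚ (m ℕ.^ suc u)) ⟩
    increment m + 1ℚ * ℕ→ℚ (m ℕ.^ suc u)
      ≡⟨ cong (λ k → increment m + ℕ→ℚ k * ℕ→ℚ (m ℕ.^ suc u)) (nCn≡1 (suc u)) ⟨
    increment m + ℕ→ℚ (suc u C suc u) * ℕ→ℚ (m ℕ.^ suc u)
      ≡⟨ binomial m (suc u) ⟩
    ℕ→ℚ (suc m ℕ.^ suc u) ∎

-- Bernoulli numbers

-- Defs keeps its list lookup private; the metavariable below is solved to it.
mutual
  lookup₀ : List ℚ → ℕ → ℚ
  lookup₀ = _

  Bernoulli-lookup₀ : ∀ m xs → bernoulliList m ≡ xs → Bernoulli m ≡ lookup₀ xs m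
  Bernoulli-lookup₀ m xs eq rewrite eq = refl

lookup₀-++ˡ : ∀ xs {ys} j → j < length xs → lookup₀ (xs ++ ys) j ≡ lookup₀ xs j
lookup₀-++ˡ (x ∷ xs) zero    _       = refl
lookup₀-++ˡ (x ∷ xs) (suc j) (s≤s p) = lookup₀-++ˡ xs j p

lookup₀-last : ∀ xs y {j} → length xs ≡ j → lookup₀ (xs ++ y ∷ []) j ≡ y
lookup₀-last []       y refl = refl
lookup₀-last (x ∷ xs) y refl = lookup₀-last xs y refl

length-bernoulliList : ∀ m → length (bernoulliList m) ≡ suc m
length-bernoulliList zero    = refl
length-bernoulliList (suc m) = trans (List.length-++ (bernoulliList m))
  (trans (ℕ.+-comm _ 1) (cong suc (length-bernoulliList m)))

lookup₀-bernoulliList : ∀ m j → j ≤ m → lookup₀ (bernoulliList m) j ≡ Bernoulli j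
lookup₀-bernoulliList zero    zero    _ = refl
lookup₀-bernoulliList (suc m) j j≤1+m with ℕ.m≤n⇒m<n∨m≡n j≤1+m
... | inj₂ refl = refl
... | inj₁ (s≤s j≤m) = trans
  (lookup₀-++ˡ (bernoulliList m) j (subst (j <_) (sym (length-bernoulliList m)) (s≤s j≤m)))
  (lookup₀-bernoulliList m j j≤m)

-- The value `0 ^ m` joins the initial condition at `m = 0` to the vanishing for positive `m`. There
-- the definition of the top entry is the recurrence solved for it, its coefficient being `suc m`.
Bernoulli-recurrence : ∀ m →
  Σ< (suc m) (λ j → ℕ→ℚ (suc m C j) * Bernoulli j) ≡ ℕ→ℚ (0 ℕ.^ m)
Bernoulli-recurrence zero    = refl
Bernoulli-recurrence (suc m) = begin
  s + ℕ→ℚ (suc (suc m) C suc m) * Bernoulli (suc m)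
    ≡⟨ cong₂ (λ k b → s + ℕ→ℚ k * b) 2+mC1+m Bernoulli-suc ⟩
  s + ℕ→ℚ (suc (suc m)) * (- (s * inv))
    ≡⟨ rearrange s (ℕ→ℚ (suc (suc m))) inv ⟩
  s - s * (ℕ→ℚ (suc (suc m)) * inv)
    ≡⟨ cong (λ x → s - s * x) (d*[z/d]≡z (suc (suc m)) (ℤ.+ 1)) ⟩
  s - s * 1ℚ
    ≡⟨ cancel s ⟩
  0ℚ ∎
  where
  inv = (ℤ.+ 1) / suc (suc m)
  s = Σ< (suc m) (λ j → ℕ→ℚ (suc (suc m) C j) * Bernoulli j)
  rearrange : ∀ s d i → s + d * (- (s * i)) ≡ s - s * (d * i)
  rearrange = solve-∀ ℚ-ring
  cancel : ∀ s → s - s * 1ℚ ≡ 0ℚ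
  cancel = solve-∀ ℚ-ring
  2+mC1+m : suc (suc m) C suc m ≡ suc (suc m)
  2+mC1+m = [1+n]Cn≡1+n (suc m)
  Bernoulli-suc : Bernoulli (suc m) ≡ - (s * inv)
  Bernoulli-suc = trans
    (lookup₀-last (bernoulliList m) _ (length-bernoulliList m))
    (cong (λ x → - (x * inv)) (Σ-cong (suc m) (λ j j<1+m →
      cong (ℕ→ℚ (suc (suc m) C j) *_) (lookup₀-bernoulliList m j (ℕ.≤-pred j<1+m)))))

-- The exponential coefficients of `nD / (e^(nD) - 1)`.
scaledBernoulli : ℕ → ℕ → ℚ
scaledBernoulli n h = Bernoulli h * ℕ→ℚ (n ℕ.^ h)

-- The powers of `n` in each term combine to `n ^ v`. Two lengths are used: `u = v + 1` to solve for
-- the top Bernoulli number, and `u = v` for the product with `diff n`.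
scaledBernoulli-recurrence : ∀ n {u} v → u ≤ suc v →
  Σ< u (λ i → ℕ→ℚ (u C i) * scaledBernoulli n i * ℕ→ℚ (n ℕ.^ (v ∸ i))) ≡
  ℕ→ℚ (n ℕ.^ v) * Σ< u (λ i → ℕ→ℚ (u C i) * Bernoulli i)
scaledBernoulli-recurrence n {u} v u≤1+v = trans
  (Σ-cong u λ i i<u → begin
    ℕ→ℚ (u C i) * (Bernoulli i * ℕ→ℚ (n ℕ.^ i)) * ℕ→ℚ (n ℕ.^ (v ∸ i))
      ≡⟨ regroup (ℕ→ℚ (u C i)) (Bernoulli i) (ℕ→ℚ (n ℕ.^ i)) (ℕ→ℚ (n ℕ.^ (v ∸ i))) ⟩
    (ℕ→ℚ (n ℕ.^ i) * ℕ→ℚ (n ℕ.^ (v ∸ i))) * (ℕ→ℚ (u C i) * Bernoulli i)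
      ≡⟨ cong (_* (ℕ→ℚ (u C i) * Bernoulli i)) (power i (ℕ.≤-pred (ℕ.≤-trans i<u u≤1+v))) ⟩
    ℕ→ℚ (n ℕ.^ v) * (ℕ→ℚ (u C i) * Bernoulli i) ∎)
  (sym (*-distribˡ-Σ u (ℕ→ℚ (n ℕ.^ v)) (λ i → ℕ→ℚ (u C i) * Bernoulli i)))
  where
  regroup : ∀ c b x y → c * (b * x) * y ≡ (x * y) * (c * b)
  regroup = solve-∀ ℚ-ring
  power : ∀ i → i ≤ v → ℕ→ℚ (n ℕ.^ i) * ℕ→ℚ (n ℕ.^ (v ∸ i)) ≡ ℕ→ℚ (n ℕ.^ v)
  power i i≤v = trans (sym (ℕ→ℚ-homo-* (n ℕ.^ i) (n ℕ.^ (v ∸ i))))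
    (cong ℕ→ℚ (trans (sym (ℕ.^-distribˡ-+-* n i (v ∸ i))) (cong (n ℕ.^_) (ℕ.m+[n∸m]≡n i≤v))))

-- Integrality up to a multiplicative set of denominators

IsInteger : ℚ → Set
IsInteger q = Σ ℤ (λ z → q ≡ ι z)

ℕ-isInteger : ∀ n → IsInteger (ℕ→ℚ n)
ℕ-isInteger n = ℤ.+ n , refl

+-isInteger : ∀ {p q} → IsInteger p → IsInteger q → IsInteger (p + q)
+-isInteger (x , refl) (y , refl) = x ℤ.+ y , sym (ι-homo-+ x y)

*-isInteger : ∀ {p q} → IsInteger p → IsInteger q → IsInteger (p * q)
*-isInteger (x , refl) (y , refl) = x ℤ.* y , sym (ι-homo-* x y)

neg-isInteger : ∀ {p} → IsInteger p → IsInteger (- p)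
neg-isInteger (x , refl) = ℤ.- x , sym (ι-homo‿- x)

Σ-isInteger : ∀ m {f} → (∀ i → IsInteger (f i)) → IsInteger (Σ< m f)
Σ-isInteger zero    f∈ℤ = ℕ-isInteger 0
Σ-isInteger (suc m) f∈ℤ = +-isInteger (Σ-isInteger m f∈ℤ) (f∈ℤ m)

module Localisation (S : ℕ → Set) (1∈S : S 1) (*∈S : ∀ {d e} → S d → S e → S (d ℕ.* e)) where

  Local : ℚ → Set
  Local q = Σ ℕ (λ d → S d × IsInteger (ℕ→ℚ d * q))

  isInteger⇒local : ∀ {q} → IsInteger q → Local q
  isInteger⇒local q∈ℤ = 1 , 1∈S , *-isInteger (ℕ-isInteger 1) q∈ℤ

  *-local : ∀ {p q} → Local p → Local q → Local (p * q)
  *-local {p} {q} (d , d∈S , dp∈ℤ) (e , e∈S , eq∈ℤ) = d ℕ.* e , *∈S d∈S e∈S ,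
    subst IsInteger
      (trans (interchange (ℕ→ℚ d) p (ℕ→ℚ e) q) (cong (_* (p * q)) (sym (ℕ→ℚ-homo-* d e))))
      (*-isInteger dp∈ℤ eq∈ℤ)
    where
    interchange : ∀ d p e q → d * p * (e * q) ≡ d * e * (p * q)
    interchange = solve-∀ ℚ-ring

  +-local : ∀ {p q} → Local p → Local q → Local (p + q)
  +-local {p} {q} (d , d∈S , dp∈ℤ) (e , e∈S , eq∈ℤ) = d ℕ.* e , *∈S d∈S e∈S ,
    subst IsInteger
      (trans (common (ℕ→ℚ d) p (ℕ→ℚ e) q) (cong (_* (p + q)) (sym (ℕ→ℚ-homo-* d e))))
      (+-isInteger (*-isInteger (ℕ-isInteger e) dp∈ℤ) (*-isInteger (ℕ-isInteger d) eq∈ℤ))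
    where
    common : ∀ d p e q → e * (d * p) + d * (e * q) ≡ d * e * (p + q)
    common = solve-∀ ℚ-ring

  neg-local : ∀ {p} → Local p → Local (- p)
  neg-local {p} (d , d∈S , dp∈ℤ) =
    d , d∈S , subst IsInteger (neg-distribʳ-* (ℕ→ℚ d) p) (neg-isInteger dp∈ℤ)

  Σ-local : ∀ m {f} → (∀ i → i < m → Local (f i)) → Local (Σ< m f)
  Σ-local zero    f∈ = isInteger⇒local (ℕ-isInteger 0)
  Σ-local (suc m) f∈ =
    +-local (Σ-local m (λ i i<m → f∈ i (ℕ.m<n⇒m<1+n i<m))) (f∈ m ℕ.≤-refl)

  /-local : ∀ {d q} → S d → Local (ℕ→ℚ d * q) → Local q
  /-local {d} {q} d∈S (e , e∈S , edq∈ℤ) = e ℕ.* d , *∈S e∈S d∈S ,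
    subst IsInteger
      (trans (sym (*-assoc (ℕ→ℚ e) (ℕ→ℚ d) q)) (cong (_* q) (sym (ℕ→ℚ-homo-* e d))))
      edq∈ℤ

-- Coprime multipliers and the quotients n^s / (s+1)

*-coprime : ∀ {n a b} → Coprime a n → Coprime b n → Coprime (a ℕ.* b) n
*-coprime a⊥n b⊥n (d∣ab , d∣n) = b⊥n
  (Coprimality.coprime-divisor (λ (e∣d , e∣a) → a⊥n (e∣a , ∣-trans e∣d d∣n)) d∣ab , d∣n)

^-coprime : ∀ {n a} j → Coprime a n → Coprime (a ℕ.^ j) n
^-coprime {n} zero    a⊥n = Coprimality.1-coprimeTo n
^-coprime     (suc j) a⊥n = *-coprime a⊥n (^-coprime j a⊥n)

bézout-isInteger : ∀ {d e q} x y → 1 ℕ.+ y ℕ.* e ≡ x ℕ.* d →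
  IsInteger (ℕ→ℚ d * q) → IsInteger (ℕ→ℚ e * q) → IsInteger q
bézout-isInteger {d} {e} {q} x y 1+ye≡xd dq∈ℤ eq∈ℤ = subst IsInteger
  (begin
    ℕ→ℚ x * (ℕ→ℚ d * q) - ℕ→ℚ y * (ℕ→ℚ e * q)
      ≡⟨ factor (ℕ→ℚ x) (ℕ→ℚ y) (ℕ→ℚ d) (ℕ→ℚ e) q ⟩
    ℕ→ℚ x * ℕ→ℚ d * q - ℕ→ℚ y * ℕ→ℚ e * q
      ≡⟨ cong₂ (λ u v → u * q - v * q) (ℕ→ℚ-homo-* x d) (ℕ→ℚ-homo-* y e) ⟨
    ℕ→ℚ (x ℕ.* d) * q - ℕ→ℚ (y ℕ.* e) * q
      ≡⟨ cong (λ u → u * q - ℕ→ℚ (y ℕ.* e) * q)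
           (trans (sym (ℕ→ℚ-homo-+ 1 (y ℕ.* e))) (cong ℕ→ℚ 1+ye≡xd)) ⟨
    (1ℚ + ℕ→ℚ (y ℕ.* e)) * q - ℕ→ℚ (y ℕ.* e) * q
      ≡⟨ collapse (ℕ→ℚ (y ℕ.* e)) q ⟩
    q ∎)
  (+-isInteger (*-isInteger (ℕ-isInteger x) dq∈ℤ)
               (neg-isInteger (*-isInteger (ℕ-isInteger y) eq∈ℤ)))
  where
  factor : ∀ x y d e q → x * (d * q) - y * (e * q) ≡ x * d * q - y * e * q
  factor = solve-∀ ℚ-ring
  collapse : ∀ z q → (1ℚ + z) * q - z * q ≡ q
  collapse = solve-∀ ℚ-ring

-- A Bézout relation writes `q` as an integer combination of `d q` and `e q`. Over the naturals it
-- comes in two forms, according to which product is the larger.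
coprime-isInteger : ∀ {d e q} → Coprime d e →
  IsInteger (ℕ→ℚ d * q) → IsInteger (ℕ→ℚ e * q) → IsInteger q
coprime-isInteger d⊥e dq∈ℤ eq∈ℤ with Coprimality.coprime-Bézout d⊥e
... | Bézout.+- x y eq = bézout-isInteger x y eq dq∈ℤ eq∈ℤ
... | Bézout.-+ x y eq = bézout-isInteger y x eq eq∈ℤ dq∈ℤ

-- If g = gcd(s+1, n) > 1, then dividing s+1 by g costs at least one factor n of n^s,
-- so the claim descends to (s+1)/g.
coprime-denominator : ∀ n s → ∃₂ λ c e → Coprime c n × c ℕ.* n ℕ.^ s ≡ suc s ℕ.* e
coprime-denominator n = <-rec _ step
  where
  Claim : ℕ → Set
  Claim s = ∃₂ λ c e → Coprime c n × c ℕ.* n ℕ.^ s ≡ suc s ℕ.* e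
  regroup : ∀ c a g n′ b x e → c ℕ.* b ≡ x ℕ.* e →
    c ℕ.* (a ℕ.* ((n′ ℕ.* g) ℕ.* b)) ≡ (x ℕ.* g) ℕ.* (a ℕ.* (n′ ℕ.* e))
  regroup c a g n′ b x e eq = trans (p c a g n′ b) (trans (cong (λ z → z ℕ.* (a ℕ.* n′ ℕ.* g)) eq) (q a g n′ x e))
    where
    p : ∀ c a g n′ b → c ℕ.* (a ℕ.* ((n′ ℕ.* g) ℕ.* b)) ≡ (c ℕ.* b) ℕ.* (a ℕ.* n′ ℕ.* g)
    p = ℕ-solve-∀
    q : ∀ a g n′ x e → (x ℕ.* e) ℕ.* (a ℕ.* n′ ℕ.* g) ≡ (x ℕ.* g) ℕ.* (a ℕ.* (n′ ℕ.* e))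
    q = ℕ-solve-∀
  descend : ∀ {s} g → g ≢ 1 → g ∣ suc s → g ∣ n → (∀ {t} → t < s → Claim t) → Claim s
  descend {s} 0 g≢1 (divides k eq) _ _ = contradiction (trans eq (ℕ.*-zeroʳ k)) λ ()
  descend 1 g≢1 _ _ _ = contradiction refl g≢1
  descend (suc (suc _)) g≢1 (divides zero ()) _ _
  descend {s} g@(suc (suc _)) g≢1 (divides (suc t) 1+s≡[1+t]g) (divides n′ n≡n′g) rec
    with t<s ← ℕ.≤-pred (subst (suc t <_) (sym 1+s≡[1+t]g) (ℕ.m<m*n (suc t) g (s≤s (s≤s z≤n))))
    with rec t<s
  ... | c , e , c⊥n , cnᵗ≡[1+t]e =
    -- One factor `n = n′ * g` of `n ^ s` supplies the `g` by which `suc s` exceeds `suc t`; the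
    -- powers left over beside `n ^ t` go into the quotient.
    c , n ℕ.^ (s ∸ suc t) ℕ.* (n′ ℕ.* e) , c⊥n , (begin
      c ℕ.* n ℕ.^ s
        ≡⟨ cong (λ k → c ℕ.* n ℕ.^ k) (ℕ.m∸n+n≡m t<s) ⟨
      c ℕ.* n ℕ.^ (s ∸ suc t ℕ.+ suc t)
        ≡⟨ cong (c ℕ.*_) (ℕ.^-distribˡ-+-* n (s ∸ suc t) (suc t)) ⟩
      c ℕ.* (n ℕ.^ (s ∸ suc t) ℕ.* (n ℕ.* n ℕ.^ t))
        ≡⟨ cong (λ k → c ℕ.* (n ℕ.^ (s ∸ suc t) ℕ.* (k ℕ.* n ℕ.^ t))) n≡n′g ⟩
      c ℕ.* (n ℕ.^ (s ∸ suc t) ℕ.* ((n′ ℕ.* g) ℕ.* n ℕ.^ t))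
        ≡⟨ regroup c (n ℕ.^ (s ∸ suc t)) g n′ (n ℕ.^ t) (suc t) e cnᵗ≡[1+t]e ⟩
      (suc t ℕ.* g) ℕ.* (n ℕ.^ (s ∸ suc t) ℕ.* (n′ ℕ.* e))
        ≡⟨ cong (ℕ._* (n ℕ.^ (s ∸ suc t) ℕ.* (n′ ℕ.* e))) 1+s≡[1+t]g ⟨
      suc s ℕ.* (n ℕ.^ (s ∸ suc t) ℕ.* (n′ ℕ.* e)) ∎)
  step : ∀ s → (∀ {t} → t < s → Claim t) → Claim s
  step s rec with gcd (suc s) n ℕ.≟ 1
  ... | yes g≡1 = suc s , n ℕ.^ s , Coprimality.gcd≡1⇒coprime g≡1 , refl
  ... | no  g≢1 = descend (gcd (suc s) n) g≢1 (gcd[m,n]∣m (suc s) n) (gcd[m,n]∣n (suc s) n) rec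

-- With `m = d + j` this reads `(m+1 C j) / (m+1) = (m C j) / (m-j+1)`. It moves the denominator
-- `m+1` of the Bernoulli recurrence to where `n^(m-j)` can control it.
C-absorb : ∀ d j → ((suc d ℕ.+ j) C j) ℕ.* suc d ≡ suc (d ℕ.+ j) ℕ.* ((d ℕ.+ j) C j)
C-absorb d j = ℕ.*-cancelʳ-≡ _ _ (d ! ℕ.* j !) (begin
  ((suc d ℕ.+ j) C j) ℕ.* suc d ℕ.* (d ! ℕ.* j !)
    ≡⟨ regroup ((suc d ℕ.+ j) C j) (suc d) (d !) (j !) ⟩
  ((suc d ℕ.+ j) C j) ℕ.* (suc d ! ℕ.* j !)
    ≡⟨ [m+n]Cn*[m!*n!]≡[m+n]! (suc d) j ⟩
  suc (d ℕ.+ j) ℕ.* (d ℕ.+ j) !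
    ≡⟨ cong (suc (d ℕ.+ j) ℕ.*_) ([m+n]Cn*[m!*n!]≡[m+n]! d j) ⟨
  suc (d ℕ.+ j) ℕ.* (((d ℕ.+ j) C j) ℕ.* (d ! ℕ.* j !))
    ≡⟨ ℕ.*-assoc (suc (d ℕ.+ j)) ((d ℕ.+ j) C j) (d ! ℕ.* j !) ⟨
  suc (d ℕ.+ j) ℕ.* ((d ℕ.+ j) C j) ℕ.* (d ! ℕ.* j !) ∎)
  where
  instance _ = d ℕ.!* j !≢0
  regroup : ∀ c e x y → c ℕ.* e ℕ.* (x ℕ.* y) ≡ c ℕ.* (e ℕ.* x ℕ.* y)
  regroup = ℕ-solve-∀

-- Denominators of n^h B_h are coprime to n

module AwayFrom (n : ℕ) =
  Localisation (λ d → Coprime d n) (Coprimality.1-coprimeTo n) *-coprime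

module _ (n : ℕ) where
  open AwayFrom n

  [n^s]/[1+s] : ℕ → ℚ
  [n^s]/[1+s] s = ℕ→ℚ (n ℕ.^ s) * (ℤ.+ 1 / suc s)

  [1+s]*[n^s]/[1+s]≡n^s : ∀ s → ℕ→ℚ (suc s) * [n^s]/[1+s] s ≡ ℕ→ℚ (n ℕ.^ s)
  [1+s]*[n^s]/[1+s]≡n^s s = begin
    ℕ→ℚ (suc s) * (ℕ→ℚ (n ℕ.^ s) * (ℤ.+ 1 / suc s))
      ≡⟨ exchange (ℕ→ℚ (suc s)) (ℕ→ℚ (n ℕ.^ s)) (ℤ.+ 1 / suc s) ⟩
    ℕ→ℚ (n ℕ.^ s) * (ℕ→ℚ (suc s) * (ℤ.+ 1 / suc s))
      ≡⟨ cong (ℕ→ℚ (n ℕ.^ s) *_) (d*[z/d]≡z (suc s) (ℤ.+ 1)) ⟩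
    ℕ→ℚ (n ℕ.^ s) * 1ℚ
      ≡⟨ *-identityʳ (ℕ→ℚ (n ℕ.^ s)) ⟩
    ℕ→ℚ (n ℕ.^ s) ∎
    where
    exchange : ∀ x y z → x * (y * z) ≡ y * (x * z)
    exchange = solve-∀ ℚ-ring

  [n^s]/[1+s]-local : ∀ s → Local ([n^s]/[1+s] s)
  [n^s]/[1+s]-local s with coprime-denominator n s
  ... | c , e , c⊥n , cnˢ≡[1+s]e = c , c⊥n , ℤ.+ e ,
    ℕ→ℚ-cancelˡ (suc s) (begin
      ℕ→ℚ (suc s) * (ℕ→ℚ c * [n^s]/[1+s] s)
        ≡⟨ exchange (ℕ→ℚ (suc s)) (ℕ→ℚ c) ([n^s]/[1+s] s) ⟩
      ℕ→ℚ c * (ℕ→ℚ (suc s) * [n^s]/[1+s] s)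
        ≡⟨ cong (ℕ→ℚ c *_) ([1+s]*[n^s]/[1+s]≡n^s s) ⟩
      ℕ→ℚ c * ℕ→ℚ (n ℕ.^ s)
        ≡⟨ ℕ→ℚ-homo-* c (n ℕ.^ s) ⟨
      ℕ→ℚ (c ℕ.* n ℕ.^ s)
        ≡⟨ cong ℕ→ℚ cnˢ≡[1+s]e ⟩
      ℕ→ℚ (suc s ℕ.* e)
        ≡⟨ ℕ→ℚ-homo-* (suc s) e ⟩
      ℕ→ℚ (suc s) * ℕ→ℚ e ∎)
    where
    exchange : ∀ x y z → x * (y * z) ≡ y * (x * z)
    exchange = solve-∀ ℚ-ring

  -- Solving the recurrence for its last term divides by `suc m`, which may share factors with `n`.
  -- Absorption replaces this by divisions of `n^(m-j)` by `m-j+1`, and of `n^m` by `m+1`, all of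
  -- which `[n^s]/[1+s]-local` covers.
  scaledBernoulli-step : ∀ m → scaledBernoulli n m ≡
    ℕ→ℚ (0 ℕ.^ m) * [n^s]/[1+s] m
      - Σ< m (λ j → ℕ→ℚ (m C j) * [n^s]/[1+s] (m ∸ j) * scaledBernoulli n j)
  scaledBernoulli-step m = ℕ→ℚ-cancelˡ (suc m) (begin
    M * X m
      ≡⟨ isolate (Σ< m weighted) (M * X m) ⟩
    (Σ< m weighted + M * X m * 1ℚ) - Σ< m weighted
      ≡⟨ cong (λ x → Σ< m weighted + x - Σ< m weighted) (cong₂ (λ k l → ℕ→ℚ k * X m * ℕ→ℚ (n ℕ.^ l))
           ([1+n]Cn≡1+n m) (ℕ.n∸n≡0 m)) ⟨
    Σ< (suc m) weighted - Σ< m weighted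
      ≡⟨ cong (_- Σ< m weighted) (trans (scaledBernoulli-recurrence n m ℕ.≤-refl)
           (cong (ℕ→ℚ (n ℕ.^ m) *_) (Bernoulli-recurrence m))) ⟩
    ℕ→ℚ (n ℕ.^ m) * ℕ→ℚ (0 ℕ.^ m) - Σ< m weighted
      ≡⟨ cong₂ (λ x y → x * ℕ→ℚ (0 ℕ.^ m) - y) (sym ([1+s]*[n^s]/[1+s]≡n^s m))
           (trans (Σ-cong m (λ j j<m → sym (absorb j (ℕ.<⇒≤ j<m)))) (sym (*-distribˡ-Σ m M term))) ⟩
    M * R m * ℕ→ℚ (0 ℕ.^ m) - M * Σ< m term
      ≡⟨ factor M (R m) (ℕ→ℚ (0 ℕ.^ m)) (Σ< m term) ⟩
    M * (ℕ→ℚ (0 ℕ.^ m) * R m - Σ< m term) ∎)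
    where
    M = ℕ→ℚ (suc m)
    R X weighted term : ℕ → ℚ
    R = [n^s]/[1+s]
    X = scaledBernoulli n
    weighted j = ℕ→ℚ (suc m C j) * X j * ℕ→ℚ (n ℕ.^ (m ∸ j))
    term j = ℕ→ℚ (m C j) * R (m ∸ j) * X j
    isolate : ∀ s x → x ≡ (s + x * 1ℚ) - s
    isolate = solve-∀ ℚ-ring
    factor : ∀ x r z s → x * r * z - x * s ≡ x * (z * r - s)
    factor = solve-∀ ℚ-ring
    regroupˡ : ∀ a b r x → a * (b * r * x) ≡ (a * b) * (r * x)
    regroupˡ = solve-∀ ℚ-ring
    regroupʳ : ∀ c d r x → (c * d) * (r * x) ≡ c * x * (d * r)
    regroupʳ = solve-∀ ℚ-ring
    absorbℕ : ∀ j → j ≤ m → (suc m C j) ℕ.* suc (m ∸ j) ≡ suc m ℕ.* (m C j)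
    absorbℕ j j≤m = subst (λ k → (suc k C j) ℕ.* suc (m ∸ j) ≡ suc k ℕ.* (k C j))
      (ℕ.m∸n+n≡m j≤m) (C-absorb (m ∸ j) j)
    absorb : ∀ j → j ≤ m → M * term j ≡ weighted j
    absorb j j≤m = begin
      M * (ℕ→ℚ (m C j) * R (m ∸ j) * X j)
        ≡⟨ regroupˡ M (ℕ→ℚ (m C j)) (R (m ∸ j)) (X j) ⟩
      (M * ℕ→ℚ (m C j)) * (R (m ∸ j) * X j)
        ≡⟨ cong (_* (R (m ∸ j) * X j)) (trans (sym (ℕ→ℚ-homo-* (suc m) (m C j)))
             (trans (cong ℕ→ℚ (sym (absorbℕ j j≤m))) (ℕ→ℚ-homo-* (suc m C j) (suc (m ∸ j))))) ⟩
      (ℕ→ℚ (suc m C j) * ℕ→ℚ (suc (m ∸ j))) * (R (m ∸ j) * X j)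
        ≡⟨ regroupʳ (ℕ→ℚ (suc m C j)) (ℕ→ℚ (suc (m ∸ j))) (R (m ∸ j)) (X j) ⟩
      ℕ→ℚ (suc m C j) * X j * (ℕ→ℚ (suc (m ∸ j)) * R (m ∸ j))
        ≡⟨ cong (ℕ→ℚ (suc m C j) * X j *_) ([1+s]*[n^s]/[1+s]≡n^s (m ∸ j)) ⟩
      weighted j ∎

  scaledBernoulli-local : ∀ m → Local (scaledBernoulli n m)
  scaledBernoulli-local = <-rec _ λ m rec → subst Local (sym (scaledBernoulli-step m))
    (+-local (*-local (isInteger⇒local (ℕ-isInteger (0 ℕ.^ m))) ([n^s]/[1+s]-local m))
      (neg-local (Σ-local m λ j j<m →
        *-local (*-local (isInteger⇒local (ℕ-isInteger (m C j))) ([n^s]/[1+s]-local (m ∸ j)))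
                (rec j<m))))

-- Denominators that are powers of n

PowerOf : ℕ → ℕ → Set
PowerOf n d = Σ ℕ (λ j → d ≡ n ℕ.^ j)

*-powerOf : ∀ {n d e} → PowerOf n d → PowerOf n e → PowerOf n (d ℕ.* e)
*-powerOf {n} (i , refl) (j , refl) = i ℕ.+ j , sym (ℕ.^-distribˡ-+-* n i j)

module Inverting (n : ℕ) = Localisation (PowerOf n) (0 , refl) *-powerOf

local⇒isInteger : ∀ {n q} → AwayFrom.Local n q → Inverting.Local n q → IsInteger q
local⇒isInteger (d , d⊥n , dq∈ℤ) (_ , (j , refl) , nʲq∈ℤ) =
  coprime-isInteger (Coprimality.sym (^-coprime j (Coprimality.sym d⊥n))) dq∈ℤ nʲq∈ℤ

-- Binomials with integer top, and the case k = 0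

falling*!≡! : ∀ s h → falling (ℤ.+ (s ℕ.+ h)) h ℤ.* ℤ.+ (s !) ≡ ℤ.+ ((s ℕ.+ h) !)
falling*!≡! s zero    = trans (ℤ.*-identityˡ (ℤ.+ (s !))) (cong (λ k → ℤ.+ (k !)) (sym (ℕ.+-identityʳ s)))
falling*!≡! s (suc h) = begin
  falling (ℤ.+ (s ℕ.+ suc h)) h ℤ.* (ℤ.+ (s ℕ.+ suc h) ℤ.- ℤ.+ h) ℤ.* ℤ.+ (s !)
    ≡⟨ cong (λ k → falling (ℤ.+ k) h ℤ.* (ℤ.+ k ℤ.- ℤ.+ h) ℤ.* ℤ.+ (s !)) (ℕ.+-suc s h) ⟩
  falling (ℤ.+ (suc s ℕ.+ h)) h ℤ.* (ℤ.+ (suc s ℕ.+ h) ℤ.- ℤ.+ h) ℤ.* ℤ.+ (s !)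
    ≡⟨ cong (λ x → falling (ℤ.+ (suc s ℕ.+ h)) h ℤ.* x ℤ.* ℤ.+ (s !)) last-factor ⟩
  falling (ℤ.+ (suc s ℕ.+ h)) h ℤ.* ℤ.+ suc s ℤ.* ℤ.+ (s !)
    ≡⟨ ℤ.*-assoc (falling (ℤ.+ (suc s ℕ.+ h)) h) (ℤ.+ suc s) (ℤ.+ (s !)) ⟩
  falling (ℤ.+ (suc s ℕ.+ h)) h ℤ.* (ℤ.+ suc s ℤ.* ℤ.+ (s !))
    ≡⟨ cong (falling (ℤ.+ (suc s ℕ.+ h)) h ℤ.*_) (ℤ.pos-* (suc s) (s !)) ⟨
  falling (ℤ.+ (suc s ℕ.+ h)) h ℤ.* ℤ.+ (suc s !)
    ≡⟨ falling*!≡! (suc s) h ⟩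
  ℤ.+ ((suc s ℕ.+ h) !)
    ≡⟨ cong (λ k → ℤ.+ (k !)) (ℕ.+-suc s h) ⟨
  ℤ.+ ((s ℕ.+ suc h) !) ∎
  where
  -- The last factor of the falling product is absorbed by `s !`, so the induction on `h` raises
  -- `s`.
  last-factor : ℤ.+ (suc s ℕ.+ h) ℤ.- ℤ.+ h ≡ ℤ.+ suc s
  last-factor = trans (ℤ.+-assoc (ℤ.+ suc s) (ℤ.+ h) (ℤ.- ℤ.+ h))
    (trans (cong (λ x → ℤ.+ suc s ℤ.+ x) (ℤ.+-inverseʳ (ℤ.+ h))) (ℤ.+-identityʳ (ℤ.+ suc s)))

binomℤ≡C : ∀ s h → binomℤ (ℤ.+ (s ℕ.+ h)) h ≡ ℕ→ℚ ((s ℕ.+ h) C h)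
binomℤ≡C s h = ℕ→ℚ-cancelˡ (h !) (begin
  ℕ→ℚ (h !) * binomℤ (ℤ.+ (s ℕ.+ h)) h
    ≡⟨ d*[z/d]≡z (h !) (falling (ℤ.+ (s ℕ.+ h)) h) ⟩
  ι (falling (ℤ.+ (s ℕ.+ h)) h)
    ≡⟨ cong ι falling≡ ⟩
  ℕ→ℚ (h ! ℕ.* ((s ℕ.+ h) C h))
    ≡⟨ ℕ→ℚ-homo-* (h !) ((s ℕ.+ h) C h) ⟩
  ℕ→ℚ (h !) * ℕ→ℚ ((s ℕ.+ h) C h) ∎)
  where
  instance
    _ = h ℕ.!≢0
    _ = s ℕ.!≢0
  falling≡ : falling (ℤ.+ (s ℕ.+ h)) h ≡ ℤ.+ (h ! ℕ.* ((s ℕ.+ h) C h))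
  falling≡ = ℤ.*-cancelʳ-≡ _ _ (ℤ.+ (s !)) (begin
    falling (ℤ.+ (s ℕ.+ h)) h ℤ.* ℤ.+ (s !)
      ≡⟨ falling*!≡! s h ⟩
    ℤ.+ ((s ℕ.+ h) !)
      ≡⟨ cong (ℤ.+_) ([m+n]Cn*[m!*n!]≡[m+n]! s h) ⟨
    ℤ.+ (((s ℕ.+ h) C h) ℕ.* (s ! ℕ.* h !))
      ≡⟨ cong (ℤ.+_) (regroup ((s ℕ.+ h) C h) (s !) (h !)) ⟩
    ℤ.+ (h ! ℕ.* ((s ℕ.+ h) C h) ℕ.* s !)
      ≡⟨ ℤ.pos-* (h ! ℕ.* ((s ℕ.+ h) C h)) (s !) ⟩
    ℤ.+ (h ! ℕ.* ((s ℕ.+ h) C h)) ℤ.* ℤ.+ (s !) ∎)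
    where
    regroup : ∀ c x y → c ℕ.* (x ℕ.* y) ≡ y ℕ.* c ℕ.* x
    regroup = ℕ-solve-∀

falling-[h-1]≡0 : ∀ h → falling (ℤ.+ suc h ℤ.- ℤ.+ 1) (suc h) ≡ ℤ.+ 0
falling-[h-1]≡0 h = trans
  (cong (falling (ℤ.+ h) h ℤ.*_) (ℤ.+-inverseʳ (ℤ.+ h)))
  (ℤ.*-zeroʳ (falling (ℤ.+ h) h))

-- For positive `h` the falling product ends in the factor 0, which removes the Bernoulli number;
-- for `h = 0` it is empty and `B_0 = 1`.
binomℤ-[h-1]-isInteger : ∀ h → IsInteger (Bernoulli h * binomℤ (ℤ.+ h ℤ.- ℤ.+ 1) h)
binomℤ-[h-1]-isInteger zero    = ℕ-isInteger 1
binomℤ-[h-1]-isInteger (suc h) = ℤ.+ 0 , *-zero-congʳ (Bernoulli (suc h))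
  (ℕ→ℚ-cancelˡ (suc h !) (begin
    ℕ→ℚ (suc h !) * binomℤ (ℤ.+ suc h ℤ.- ℤ.+ 1) (suc h)
      ≡⟨ d*[z/d]≡z (suc h !) (falling (ℤ.+ suc h ℤ.- ℤ.+ 1) (suc h)) ⟩
    ι (falling (ℤ.+ suc h ℤ.- ℤ.+ 1) (suc h))
      ≡⟨ cong ι (falling-[h-1]≡0 h) ⟩
    0ℚ
      ≡⟨ *-zeroʳ (ℕ→ℚ (suc h !)) ⟨
    ℕ→ℚ (suc h !) * 0ℚ ∎))
  where instance _ = suc h ℕ.!≢0

𝒜-zero-isInteger : ∀ n → IsInteger (𝒜 n 0)
𝒜-zero-isInteger n = Σ-isInteger (suc n) λ h →
  *-isInteger (*-isInteger (binomℤ-[h-1]-isInteger h) (ℕ-isInteger (stirling1 n (h ℕ.+ 0))))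
              (ℕ-isInteger (n ℕ.^ h))

-- The triangular system and integrality for positive k

module _ (n : ℕ) where

  -- The coefficient of tˢ in (t+1)⋯(t+n-1), and its image under nD/(eⁿᴰ-1).
  private
    rising : ℕ → ℚ
    rising s = stirling n (suc s)

    a : ℕ → ℚ
    a = act (suc n) (scaledBernoulli n) rising

  𝒜-suc : ∀ s → 𝒜 n (suc s) ≡ a s
  𝒜-suc s = Σ-cong (suc n) λ h _ → begin
    Bernoulli h * binomℤ (ℤ.+ (s ℕ.+ h)) h * stirling n (h ℕ.+ suc s) * ℕ→ℚ (n ℕ.^ h)
      ≡⟨ cong₂ (λ x k → Bernoulli h * x * stirling n k * ℕ→ℚ (n ℕ.^ h))
           (binomℤ≡C s h) (ℕ.+-comm h (suc s)) ⟩
    Bernoulli h * ℕ→ℚ ((s ℕ.+ h) C h) * rising (s ℕ.+ h) * ℕ→ℚ (n ℕ.^ h)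
      ≡⟨ regroup (Bernoulli h) (ℕ→ℚ ((s ℕ.+ h) C h)) (rising (s ℕ.+ h)) (ℕ→ℚ (n ℕ.^ h)) ⟩
    ℕ→ℚ ((s ℕ.+ h) C h) * scaledBernoulli n h * rising (s ℕ.+ h) ∎
    where
    regroup : ∀ b c f x → b * c * f * x ≡ c * (b * x) * f
    regroup = solve-∀ ℚ-ring

  a-awayFrom : ∀ s → AwayFrom.Local n (a s)
  a-awayFrom s = Σ-local (suc n) λ i _ →
    *-local (*-local (isInteger⇒local (ℕ-isInteger ((s ℕ.+ i) C i))) (scaledBernoulli-local n i))
            (isInteger⇒local (ℕ-isInteger (stirling1 n (suc (s ℕ.+ i)))))
    where open AwayFrom n

  -- The product is the operator `nD`: by the Bernoulli recurrence its entry is `n` at `u = 1` and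
  -- zero elsewhere. Integrality is all that the triangular system asks of it.
  scaledBernoulli-⋆-diff-isInteger : ∀ u → IsInteger ((scaledBernoulli n ⋆ diff n) u)
  scaledBernoulli-⋆-diff-isInteger u = subst IsInteger
    (sym (trans (⋆-diff (scaledBernoulli n) n u) (scaledBernoulli-recurrence n u (ℕ.n≤1+n u))))
    (*-isInteger (ℕ-isInteger (n ℕ.^ u)) (sum u))
    where
    sum : ∀ u → IsInteger (Σ< u (λ i → ℕ→ℚ (u C i) * Bernoulli i))
    sum zero    = ℕ-isInteger 0
    sum (suc m) = ℤ.+ (0 ℕ.^ m) , Bernoulli-recurrence m

  stirling-vanishes : ∀ r → suc n ≤ r → stirling n r ≡ 0ℚ
  stirling-vanishes r n<r = cong ℕ→ℚ (stirling1-vanishes n<r)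

  n*powerSum-a : ∀ s → ℕ→ℚ n * act (suc n) (powerSum n) a s ≡
    act (suc n) (scaledBernoulli n ⋆ diff n) (stirling n) s
  n*powerSum-a s = begin
    ℕ→ℚ n * act M P a s
      ≡⟨ act-scale M P (ℕ→ℚ n) a s ⟨
    act M P (λ r → ℕ→ℚ n * a r) s
      ≡⟨ act-congʳ M P (λ r → trans (act-congʳ M β (diff-1-stirling n) r)
                                     (act-scale M β (ℕ→ℚ n) rising r)) s ⟨
    act M P (act M β (act M (diff 1) F)) s
      -- Commuting brings `P` next to `diff 1` on `F`, whose degree `n` is below the cutoff `M`, so
      -- that `act-⋆` can merge the two.
      ≡⟨ act-comm M P β (act M (diff 1) F) s ⟩
    act M β (act M P (act M (diff 1) F)) s
      ≡⟨ act-congʳ M β (λ r → trans (act-⋆ M P (diff 1) F stirling-vanishes r)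
                                     (act-congˡ M F (powerSum-⋆-diff n) r)) s ⟩
    act M β (act M (diff n) F) s
      ≡⟨ act-⋆ M β (diff n) F stirling-vanishes s ⟩
    act M (β ⋆ diff n) F s ∎
    where
    M = suc n
    P = powerSum n
    β = scaledBernoulli n
    F = stirling n

  open Inverting n

  -- The term `i = 0` of the sum of translates is `powerSum n 0 * a s`, which is `n` times `a s`,
  -- and all others have larger index. The second factor `n` is the one from
  -- `F(t+1) - F(t) = n f(t)`; each `/-local` removes one of the two.
  a-step : ∀ s → (∀ i → i < n → Local (a (s ℕ.+ suc i))) → Local (a s)
  a-step s rec = /-local (1 , sym (ℕ.^-identityʳ n)) (/-local (1 , sym (ℕ.^-identityʳ n))
    (subst Local (sym isolate)
      (+-local (isInteger⇒local total-isInteger)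
        (neg-local (*-local (isInteger⇒local (ℕ-isInteger n)) tail-local)))))
    where
    tail = Σ< n (λ i → ℕ→ℚ ((s ℕ.+ suc i) C suc i) * powerSum n (suc i) * a (s ℕ.+ suc i))
    powerSum-isInteger : ∀ i → IsInteger (powerSum n i)
    powerSum-isInteger i = Σ-isInteger n (λ j → ℕ-isInteger (j ℕ.^ i))
    tail-local : Local tail
    tail-local = Σ-local n λ i i<n →
      *-local (isInteger⇒local (*-isInteger (ℕ-isInteger ((s ℕ.+ suc i) C suc i)) (powerSum-isInteger (suc i))))
              (rec i i<n)
    total : ℚ
    total = ℕ→ℚ n * act (suc n) (powerSum n) a s
    total-isInteger : IsInteger total
    total-isInteger = subst IsInteger (sym (n*powerSum-a s)) (Σ-isInteger (suc n) λ i →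
      *-isInteger (*-isInteger (ℕ-isInteger ((s ℕ.+ i) C i)) (scaledBernoulli-⋆-diff-isInteger i))
                  (ℕ-isInteger (stirling1 n (s ℕ.+ i))))
    subtract : ∀ x y t → x * (x * y) ≡ x * (1ℚ * x * y + t) - x * t
    subtract = solve-∀ ℚ-ring
    isolate : ℕ→ℚ n * (ℕ→ℚ n * a s) ≡ total - ℕ→ℚ n * tail
    isolate = begin
      ℕ→ℚ n * (ℕ→ℚ n * a s)
        ≡⟨ subtract (ℕ→ℚ n) (a s) tail ⟩
      ℕ→ℚ n * (1ℚ * ℕ→ℚ n * a s + tail) - ℕ→ℚ n * tail
        ≡⟨ cong₂ (λ p r → ℕ→ℚ n * (1ℚ * p * a r + tail) - ℕ→ℚ n * tail)
             (powerSum-zero n) (ℕ.+-identityʳ s) ⟨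
      ℕ→ℚ n * (1ℚ * powerSum n 0 * a (s ℕ.+ 0) + tail) - ℕ→ℚ n * tail
        ≡⟨ cong (λ x → ℕ→ℚ n * x - ℕ→ℚ n * tail)
             (Σ-head n (λ i → ℕ→ℚ ((s ℕ.+ i) C i) * powerSum n i * a (s ℕ.+ i))) ⟨
      total - ℕ→ℚ n * tail ∎

  -- Descending induction on `s`, with `e` bounding the distance from `s` up to `n`. From `s = n`
  -- on, `a s` is zero because only vanishing Stirling numbers enter it.
  a-inverting : ∀ e s → n ≤ s ℕ.+ e → Local (a s)
  a-inverting zero s n≤s = subst Local
    (sym (Σ-zero (suc n) λ i _ → *-zero-congʳ (ℕ→ℚ ((s ℕ.+ i) C i) * scaledBernoulli n i)
      (stirling-vanishes (suc (s ℕ.+ i)) (s≤s (ℕ.≤-trans (subst (n ≤_) (ℕ.+-identityʳ s) n≤s) (ℕ.m≤m+n s i))))))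
    (isInteger⇒local (ℕ-isInteger 0))
  a-inverting (suc e) s n≤s+1+e = a-step s λ i _ → a-inverting e (s ℕ.+ suc i)
    (ℕ.≤-trans n≤s+1+e (subst (ℕ._≤ s ℕ.+ suc i ℕ.+ e) (sym (ℕ.+-suc s e))
      (ℕ.+-monoˡ-≤ e (subst (suc s ≤_) (sym (ℕ.+-suc s i)) (s≤s (ℕ.m≤m+n s i))))))

  𝒜-suc-isInteger : ∀ s → IsInteger (𝒜 n (suc s))
  𝒜-suc-isInteger s = subst IsInteger (sym (𝒜-suc s))
    (local⇒isInteger (a-awayFrom s) (a-inverting n s (ℕ.m≤n+m n s)))

theorem5p2 : (n k : ℕ) → Σ ℤ (λ z → 𝒜 n k ≡ z / 1)
theorem5p2 n zero    = 𝒜-zero-isInteger n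
theorem5p2 n (suc k) = 𝒜-suc-isInteger n k
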